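{- Let $m$ be a complex number and let $x$ be an indeterminate. The sequence of Eulerian-Dowling polynomials $\mathcal{A}_m(n,x)=\sum_{k=0}^n k!\,W_m(n,k)(x-1)^{n-k}$, $n\ge 0$, is the moment sequence of a family of orthogonal polynomials over the field $\mathbb{C}(x)$.
   Context: The Whitney numbers of the second kind of Dowling lattices are $W_m(n,k)=\sum_{i=k}^n\binom{n}{i}m^{i-k}S(i,k)$ (with $0^0=1$), where $S(i,k)$ are the Stirling numbers of the second kind; for $m\ne 0$ this is equivalent to $\sum_{n\ge 0} W_m(n,k)\frac{z^n}{n!}=\frac{e^z}{m^k k!}(e^{mz}-1)^k$, and $W_0(n,k)=\binom{n}{k}$. Orthogonality is meant in the formal (algebraic) sense. Let $K=\mathbb{C}(x)$. A family of orthogonal polynomials over $K$ is a sequence $(P_n(z))_{n\ge 0}$ of monic polynomials in $K[z]$ with $\deg P_n=n$ for which there is a $K$-linear functional $\mathcal{L}:K[z]\to K$ with $\mathcal{L}(1)=1$, $\mathcal{L}(P_iP_j)=0$ for all $i\ne j$, and $\mathcal{L}(P_n^2)\neq 0$ for all $n$. Its moment sequence is $(\mathcal{L}(z^n))_{n\ge 0}$. -}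

module Defs where

open import Algebra.Apartness.Bundles using (HeytingField; HeytingCommutativeRing)
open import Algebra.Bundles using (CommutativeRing; Semiring)
import Algebra.Consequences.Setoid as Consequences
open import Algebra.Core using (Op₁; Op₂)
import Algebra.Definitions as AlgebraDefinitions
import Algebra.Definitions.RawSemiring as RawSemiringOperations
open import Algebra.Module.Bundles using (LeftModule)
open import Algebra.Module.Bundles.Raw using (RawLeftModule)
import Algebra.Module.Construct.TensorUnit as TensorUnit
open import Algebra.Module.Morphism.Structures using (module LeftModuleMorphisms)
import Algebra.Properties.CommutativeSemigroup as CommutativeSemigroupProperties
import Algebra.Properties.Ring as RingProperties
import Algebra.Solver.Ring.NaturalCoefficients.Default as SemiringSolver
open import Algebra.Structures using (IsCommutativeRing)
open import Data.Empty using (⊥-elim)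
open import Data.Fin.Base using (toℕ)
open import Data.List.Base as List using (List; []; _∷_)
open import Data.Nat.Base as ℕ using (ℕ; zero; suc; _!)
open import Data.Nat.Combinatorics using (_C_)
import Data.Nat.Properties as ℕₚ
open import Data.Product.Base using (∃; _×_; _,_; proj₁; proj₂)
open import Data.Rational.Base as Rat using (ℚ; 0ℚ; 1ℚ; ½; ∣_∣)
import Data.Rational.Properties as ℚₚ
open import Data.Rational.Solver using (module +-*-Solver)
open import Data.Sum.Base as Sum using (_⊎_; inj₁; inj₂; [_,_]′)
open import Function.Base using (id; _∘_)
open import Level using (0ℓ; _⊔_) renaming (suc to lsuc)
open import Relation.Binary.Bundles using (Setoid)
open import Relation.Binary.Core using (Rel)
import Relation.Binary.Reasoning.Setoid as SetoidReasoning
open import Relation.Binary.PropositionalEquality as ≡ using (_≡_; _≢_; refl; cong; cong₂; subst)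
open import Relation.Binary.Structures using (IsEquivalence)
open import Relation.Nullary.Decidable.Core using (Dec; yes; no)
open import Relation.Nullary.Negation.Core using (¬_; contradiction)

-- Over ℝ, and hence over ℂ and ℂ(x), being nonzero is not decidable and is a
-- stronger notion than ¬ (x ≈ 0#): it carries a positive lower bound, making
-- division possible. `NonZero` is that notion, i.e. apartness from zero.
record ApartnessDomain c ℓ ν : Set (lsuc (c ⊔ ℓ ⊔ ν)) where
  field
    commutativeRing : CommutativeRing c ℓ
  open CommutativeRing commutativeRing public
  field
    NonZero        : Carrier → Set ν
    nonZero-resp   : ∀ {x y} → x ≈ y → NonZero x → NonZero y
    ¬nonZero-0     : ¬ NonZero 0#
    nonZero-1      : NonZero 1#
    nonZero-+      : ∀ {x y} → NonZero (x + y) → NonZero x ⊎ NonZero y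
    nonZero-*      : ∀ {x y} → NonZero x → NonZero y → NonZero (x * y)
    nonZero-factor : ∀ {x y} → NonZero (x * y) → NonZero x
    ¬nonZero⇒0     : ∀ {x} → ¬ NonZero x → x ≈ 0#

-- Commutativity makes one half of each two-sided law redundant.
record CommutativeRingAxioms {c ℓ} {A : Set c} (_≈_ : Rel A ℓ) (_+_ _*_ : Op₂ A) (-_ : Op₁ A)
                             (0# 1# : A) : Set (c ⊔ ℓ) where
  open AlgebraDefinitions _≈_
  field
    isEquivalence : IsEquivalence _≈_
    +-cong        : Congruent₂ _+_
    +-assoc       : Associative _+_
    +-comm        : Commutative _+_
    +-identityˡ   : LeftIdentity 0# _+_
    -‿cong        : Congruent₁ -_
    -‿inverseˡ    : LeftInverse 0# -_ _+_
    *-cong        : Congruent₂ _*_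
    *-assoc       : Associative _*_
    *-comm        : Commutative _*_
    *-identityˡ   : LeftIdentity 1# _*_
    distribʳ      : _*_ DistributesOverʳ _+_

  isCommutativeRing : IsCommutativeRing _≈_ _+_ _*_ -_ 0# 1#
  isCommutativeRing = record
    { isRing = record
      { +-isAbelianGroup = record
        { isGroup = record
          { isMonoid = record
            { isSemigroup = record
              { isMagma = record { isEquivalence = isEquivalence ; ∙-cong = +-cong }
              ; assoc = +-assoc
              }
            ; identity = comm∧idˡ⇒id +-comm +-identityˡ
            }
          ; inverse = comm∧invˡ⇒inv +-comm -‿inverseˡ
          ; ⁻¹-cong = -‿cong
          }
        ; comm = +-comm
        }
      ; *-cong = *-cong
      ; *-assoc = *-assoc
      ; *-identity = comm∧idˡ⇒id *-comm *-identityˡ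
      ; distrib = comm∧distrʳ⇒distr +-cong *-comm distribʳ
      }
    ; *-comm = *-comm
    }
    where
    setoid : Setoid c ℓ
    setoid = record { isEquivalence = isEquivalence }
    open Consequences setoid using (comm∧idˡ⇒id; comm∧invˡ⇒inv; comm∧distrʳ⇒distr)

module DomainProperties {c ℓ ν} (D : ApartnessDomain c ℓ ν) where
  open ApartnessDomain D
  open RingProperties ring

  abstract
    nonZero-factorʳ : ∀ {x y} → NonZero (x * y) → NonZero y
    nonZero-factorʳ nz = nonZero-factor (nonZero-resp (*-comm _ _) nz)

    nonZero-neg : ∀ {x} → NonZero x → NonZero (- x)
    nonZero-neg {x} nz = nonZero-factor {y = - 1#} (nonZero-resp eq nz)
      where
      open SetoidReasoning setoid
      eq : x ≈ - x * - 1#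
      eq = begin
        x             ≈⟨ -‿involutive x ⟨
        - - x         ≈⟨ -‿cong (*-identityʳ (- x)) ⟨
        - (- x * 1#)  ≈⟨ -‿distribʳ-* (- x) 1# ⟩
        - x * - 1#    ∎

    nonZero-neg⁻¹ : ∀ {x} → NonZero (- x) → NonZero x
    nonZero-neg⁻¹ nz = nonZero-resp (-‿involutive _) (nonZero-neg nz)

    cancelˡ : ∀ {d x y} → NonZero d → d * x ≈ d * y → x ≈ y
    cancelˡ {d} {x} {y} d≠0 eq = x∙y⁻¹≈ε⇒x≈y x y (¬nonZero⇒0 λ nz →
      ¬nonZero-0 (nonZero-resp zero′ (nonZero-* d≠0 nz)))
      where
      open SetoidReasoning setoid
      zero′ : d * (x - y) ≈ 0#
      zero′ = begin
        d * (x - y)        ≈⟨ distribˡ d x (- y) ⟩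
        d * x + d * - y    ≈⟨ +-cong eq (sym (-‿distribʳ-* d y)) ⟩
        d * y - d * y      ≈⟨ -‿inverseʳ (d * y) ⟩
        0#                 ∎

  infix 4 _#_
  _#_ : Carrier → Carrier → Set ν
  x # y = NonZero (x - y)

  -- A domain whose nonzero elements are invertible is a field.
  heytingField : (∀ x → NonZero x → ∃ λ y → x * y ≈ 1#) → HeytingField c ℓ ν
  heytingField inverse = record
    { Carrier = Carrier ; _≈_ = _≈_ ; _#_ = _#_
    ; _+_ = _+_ ; _*_ = _*_ ; -_ = -_ ; 0# = 0# ; 1# = 1#
    ; isHeytingField = record
      { isHeytingCommutativeRing = record
        { isCommutativeRing = isCommutativeRing
        ; isApartnessRelation = record
          { irrefl  = λ x≈y x#y → ¬nonZero-0 (nonZero-resp (x≈y⇒x∙y⁻¹≈ε x≈y) x#y)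
          ; sym     = λ {x} {y} x#y → nonZero-resp (⁻¹-anti-homo-// x y) (nonZero-neg x#y)
          ; cotrans = λ {x} {y} x#y z → nonZero-+ (nonZero-resp (split x y z) x#y)
          }
        ; #⇒invertible = λ x#y →
            let z , xz≈1 = inverse _ x#y in z , trans (*-comm _ _) xz≈1 , xz≈1
        ; invertible⇒# = λ (_ , _ , xz≈1) → nonZero-factor (nonZero-resp (sym xz≈1) nonZero-1)
        }
      ; tight = λ x y →
          (λ ¬x#y → x∙y⁻¹≈ε⇒x≈y x y (¬nonZero⇒0 ¬x#y)) ,
          (λ x≈y x#y → ¬nonZero-0 (nonZero-resp (x≈y⇒x∙y⁻¹≈ε x≈y) x#y))
      }
    }
    where
    split : ∀ x y z → x - y ≈ (x - z) + (z - y)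
    split x y z = begin
      x - y                ≈⟨ +-congʳ (+-identityʳ x) ⟨
      (x + 0#) - y         ≈⟨ +-congʳ (+-congˡ (-‿inverseˡ z)) ⟨
      (x + (- z + z)) - y  ≈⟨ +-congʳ (+-assoc x (- z) z) ⟨
      (x - z + z) - y      ≈⟨ +-assoc (x - z) z (- y) ⟩
      (x - z) + (z - y)    ∎
      where open SetoidReasoning setoid

module CauchyReals where
  open Rat using (_+_; _*_; _-_; -_; _≤_; _<_; 1/_)

  -- The rank makes the same definition serve for null sequences (I = ℕ) and
  -- for Cauchy sequences (I = ℕ × ℕ).
  Vanishes : {I : Set} → (I → ℕ) → (I → ℚ) → Set
  Vanishes {I} rank f = ∀ ε → 0ℚ < ε → ∃ λ N → ∀ i → N ℕ.≤ rank i → ∣ f i ∣ < ε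

  Null : (ℕ → ℚ) → Set
  Null = Vanishes id

  min : ℕ × ℕ → ℕ
  min (m , n) = m ℕ.⊓ n

  Cauchy : (ℕ → ℚ) → Set
  Cauchy u = Vanishes min (λ (m , n) → u m - u n)

  BoundedAway : (ℕ → ℚ) → Set
  BoundedAway u = ∃ λ δ → 0ℚ < δ × ∃ λ N → ∀ n → N ℕ.≤ n → δ ≤ ∣ u n ∣

  Bounded : {I : Set} → (I → ℕ) → (I → ℚ) → Set
  Bounded rank f = ∃ λ B → 0ℚ < B × ∃ λ N → ∀ i → N ℕ.≤ rank i → ∣ f i ∣ ≤ B

  abstract
    private
      half+half : ∀ ε → ½ * ε + ½ * ε ≡ ε
      half+half ε = ≡.trans (≡.sym (ℚₚ.*-distribʳ-+ ε ½ ½)) (ℚₚ.*-identityˡ ε)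

      <⇒≱ : ∀ {p q} → p < q → ¬ q ≤ p
      <⇒≱ p<q q≤p = ℚₚ.<-irrefl refl (ℚₚ.<-≤-trans p<q q≤p)

      *-pos : ∀ {p q} → 0ℚ < p → 0ℚ < q → 0ℚ < p * q
      *-pos {p} {q} p>0 q>0 =
        ℚₚ.positive⁻¹ (p * q) {{ℚₚ.pos*pos⇒pos p {{Rat.positive p>0}} q {{Rat.positive q>0}}}}

      halve : ∀ {ε} → 0ℚ < ε → ∃ λ η → 0ℚ < η × η + η ≡ ε
      halve {ε} ε>0 = ½ * ε , *-pos (ℚₚ.positive⁻¹ ½) ε>0 , half+half ε

      half-pos : ∀ {ε} → 0ℚ < ε → 0ℚ < ½ * ε
      half-pos = *-pos (ℚₚ.positive⁻¹ ½)

      *-mono-≤ : ∀ {a b c d} → 0ℚ ≤ a → 0ℚ ≤ d → a ≤ b → c ≤ d → a * c ≤ b * d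
      *-mono-≤ {a} {b} {c} {d} a≥0 d≥0 a≤b c≤d = ℚₚ.≤-trans
        (ℚₚ.*-monoˡ-≤-nonNeg a {{Rat.nonNegative a≥0}} c≤d)
        (ℚₚ.*-monoʳ-≤-nonNeg d {{Rat.nonNegative d≥0}} a≤b)

    -- A total version of 1/_, with value 0 at 0.
    recip : ℚ → ℚ
    recip q with q ℚₚ.≟ 0ℚ
    ... | yes _  = 0ℚ
    ... | no q≢0 = (1/ q) {{Rat.≢-nonZero q≢0}}

    private
      recip-inverse : ∀ q → ¬ q ≡ 0ℚ → q * recip q ≡ 1ℚ
      recip-inverse q q≢0 with q ℚₚ.≟ 0ℚ
      ... | yes q≡0 = contradiction q≡0 q≢0
      ... | no q≢0′ = ℚₚ.*-inverseʳ q {{Rat.≢-nonZero q≢0′}}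

      recip-pos : ∀ {q} → 0ℚ < q → 0ℚ < recip q
      recip-pos {q} q>0 with q ℚₚ.≟ 0ℚ
      ... | yes q≡0 = contradiction (≡.sym q≡0) (ℚₚ.<⇒≢ q>0)
      ... | no q≢0  = ℚₚ.positive⁻¹ _ {{ℚₚ.1/pos⇒pos q {{Rat.positive q>0}}}}

      pos⇒≢0 : ∀ {q} → 0ℚ < q → ¬ q ≡ 0ℚ
      pos⇒≢0 q>0 q≡0 = ℚₚ.<⇒≢ q>0 (≡.sym q≡0)

      *-recip-cancel : ∀ p {q} → 0ℚ < q → p * recip q * q ≡ p
      *-recip-cancel p {q} q>0 = ≡.trans (ℚₚ.*-assoc p (recip q) q)
        (≡.trans (cong (p *_) (≡.trans (ℚₚ.*-comm (recip q) q) (recip-inverse q (pos⇒≢0 q>0))))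
                 (ℚₚ.*-identityʳ p))

      m⊓n-left : ∀ {N} m n → N ℕ.≤ m ℕ.⊓ n → N ℕ.≤ m
      m⊓n-left m n le = ℕₚ.≤-trans le (ℕₚ.m⊓n≤m m n)

      m⊓n-right : ∀ {N} m n → N ℕ.≤ m ℕ.⊓ n → N ℕ.≤ n
      m⊓n-right m n le = ℕₚ.≤-trans le (ℕₚ.m⊓n≤n m n)

      ⊔-left : ∀ M N {k} → M ℕ.⊔ N ℕ.≤ k → M ℕ.≤ k
      ⊔-left M N = ℕₚ.≤-trans (ℕₚ.m≤m⊔n M N)

      ⊔-right : ∀ M N {k} → M ℕ.⊔ N ℕ.≤ k → N ℕ.≤ k
      ⊔-right M N = ℕₚ.≤-trans (ℕₚ.m≤n⊔m M N)

      ∣a∣≤∣b∣+∣a-b∣ : ∀ a b → ∣ a ∣ ≤ ∣ b ∣ + ∣ a - b ∣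
      ∣a∣≤∣b∣+∣a-b∣ a b = subst (λ t → ∣ t ∣ ≤ ∣ b ∣ + ∣ a - b ∣) eq (ℚₚ.∣p+q∣≤∣p∣+∣q∣ b (a - b))
        where
        eq : b + (a - b) ≡ a
        eq = solve 2 (λ a b → b :+ (a :- b) := a) refl a b
          where open +-*-Solver

      ∣a-b∣≡∣b-a∣ : ∀ a b → ∣ a - b ∣ ≡ ∣ b - a ∣
      ∣a-b∣≡∣b-a∣ a b = ≡.trans (cong ∣_∣ eq) (ℚₚ.∣-p∣≡∣p∣ (b - a))
        where
        eq : a - b ≡ - (b - a)
        eq = solve 2 (λ a b → a :- b := :- (b :- a)) refl a b
          where open +-*-Solver

    module _ {I : Set} {rank : I → ℕ} where
      vanishes-eventually : ∀ {f g} → (∃ λ N → ∀ i → N ℕ.≤ rank i → f i ≡ g i) →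
                            Vanishes rank f → Vanishes rank g
      vanishes-eventually (M , f≡g) f→0 ε ε>0 with f→0 ε ε>0
      ... | N , f<ε = M ℕ.⊔ N , λ i le →
        subst (λ t → ∣ t ∣ < ε) (f≡g i (⊔-left M N le)) (f<ε i (⊔-right M N le))

      vanishes-ext : ∀ {f g} → (∀ i → f i ≡ g i) → Vanishes rank f → Vanishes rank g
      vanishes-ext f≡g = vanishes-eventually (0 , λ i _ → f≡g i)

      vanishes-0 : Vanishes rank (λ _ → 0ℚ)
      vanishes-0 ε ε>0 = 0 , λ _ _ → ε>0

      vanishes-+ : ∀ {f g} → Vanishes rank f → Vanishes rank g → Vanishes rank (λ i → f i + g i)
      vanishes-+ {f} {g} f→0 g→0 ε ε>0 with f→0 (½ * ε) (half-pos ε>0) | g→0 (½ * ε) (half-pos ε>0)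
      ... | M , f<ε | N , g<ε = M ℕ.⊔ N , λ i le →
        ℚₚ.≤-<-trans (ℚₚ.∣p+q∣≤∣p∣+∣q∣ (f i) (g i))
          (subst (∣ f i ∣ + ∣ g i ∣ <_) (half+half ε)
            (ℚₚ.+-mono-< (f<ε i (⊔-left M N le)) (g<ε i (⊔-right M N le))))

      vanishes-neg : ∀ {f} → Vanishes rank f → Vanishes rank (λ i → - f i)
      vanishes-neg {f} f→0 ε ε>0 with f→0 ε ε>0
      ... | N , f<ε = N , λ i le → subst (_< ε) (≡.sym (ℚₚ.∣-p∣≡∣p∣ (f i))) (f<ε i le)

      vanishes-*ʳ : ∀ {f g} → Vanishes rank f → Bounded rank g → Vanishes rank (λ i → f i * g i)
      vanishes-*ʳ {f} {g} f→0 (B , B>0 , M , g≤B) ε ε>0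
        with f→0 (ε * recip B) (*-pos ε>0 (recip-pos B>0))
      ... | N , f<ε = M ℕ.⊔ N , λ i le →
        subst (_< ε) (≡.sym (ℚₚ.∣p*q∣≡∣p∣*∣q∣ (f i) (g i)))
          (ℚₚ.≤-<-trans
            (ℚₚ.*-monoˡ-≤-nonNeg ∣ f i ∣ {{ℚₚ.∣-∣-nonNeg (f i)}} (g≤B i (⊔-left M N le)))
            (subst (∣ f i ∣ * B <_) (*-recip-cancel ε B>0)
              (ℚₚ.*-monoˡ-<-pos B {{Rat.positive B>0}} (f<ε i (⊔-right M N le)))))

      vanishes-*ˡ : ∀ {f g} → Bounded rank f → Vanishes rank g → Vanishes rank (λ i → f i * g i)
      vanishes-*ˡ {f} {g} f≤B g→0 =
        vanishes-ext (λ i → ℚₚ.*-comm (g i) (f i)) (vanishes-*ʳ g→0 f≤B)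

      bounded-* : ∀ {f g} → Bounded rank f → Bounded rank g → Bounded rank (λ i → f i * g i)
      bounded-* {f} {g} (A , A>0 , M , f≤A) (B , B>0 , N , g≤B) =
        A * B , *-pos A>0 B>0 , M ℕ.⊔ N , λ i le →
          subst (_≤ A * B) (≡.sym (ℚₚ.∣p*q∣≡∣p∣*∣q∣ (f i) (g i)))
            (*-mono-≤ (ℚₚ.0≤∣p∣ (f i)) (ℚₚ.<⇒≤ B>0) (f≤A i (⊔-left M N le)) (g≤B i (⊔-right M N le)))

    bounded-fst : {u : ℕ → ℚ} → Bounded id u → Bounded min (u ∘ proj₁)
    bounded-fst (B , B>0 , N , u≤B) = B , B>0 , N , λ (m , n) le → u≤B m (m⊓n-left m n le)

    bounded-snd : {u : ℕ → ℚ} → Bounded id u → Bounded min (u ∘ proj₂)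
    bounded-snd (B , B>0 , N , u≤B) = B , B>0 , N , λ (m , n) le → u≤B n (m⊓n-right m n le)

    cauchy⇒bounded : ∀ {u} → Cauchy u → Bounded id u
    cauchy⇒bounded {u} u-cauchy with u-cauchy 1ℚ (ℚₚ.positive⁻¹ 1ℚ)
    ... | N , close = ∣ u N ∣ + 1ℚ , ℚₚ.+-mono-≤-< (ℚₚ.0≤∣p∣ (u N)) (ℚₚ.positive⁻¹ 1ℚ) , N , λ n le →
      ℚₚ.≤-trans (∣a∣≤∣b∣+∣a-b∣ (u n) (u N))
        (ℚₚ.+-monoʳ-≤ ∣ u N ∣ (ℚₚ.<⇒≤ (close (n , N) (ℕₚ.⊓-glb le ℕₚ.≤-refl))))

    cauchy-const : ∀ q → Cauchy (λ _ → q)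
    cauchy-const q = vanishes-ext {f = λ _ → 0ℚ} (λ _ → ≡.sym (ℚₚ.+-inverseʳ q)) vanishes-0

    cauchy-+ : ∀ {u v} → Cauchy u → Cauchy v → Cauchy (λ n → u n + v n)
    cauchy-+ {u} {v} cu cv = vanishes-ext
      (λ (m , n) → solve 4 (λ a b c d → (a :- b) :+ (c :- d) := (a :+ c) :- (b :+ d)) refl (u m) (u n) (v m) (v n))
      (vanishes-+ cu cv)
      where open +-*-Solver

    cauchy-neg : ∀ {u} → Cauchy u → Cauchy (λ n → - u n)
    cauchy-neg {u} cu = vanishes-ext
      (λ (m , n) → solve 2 (λ a b → :- (a :- b) := (:- a) :- (:- b)) refl (u m) (u n))
      (vanishes-neg cu)
      where open +-*-Solver

    cauchy-* : ∀ {u v} → Cauchy u → Cauchy v → Cauchy (λ n → u n * v n)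
    cauchy-* {u} {v} cu cv = vanishes-ext
      (λ (m , n) → solve 4 (λ a b c d → (a :- b) :* c :+ b :* (c :- d) := a :* c :- b :* d) refl (u m) (u n) (v m) (v n))
      (vanishes-+ {f = λ (m , n) → (u m - u n) * v m} {g = λ (m , n) → u n * (v m - v n)}
        (vanishes-*ʳ {g = v ∘ proj₁} cu (bounded-fst (cauchy⇒bounded cv)))
        (vanishes-*ˡ {f = u ∘ proj₂} (bounded-snd (cauchy⇒bounded cu)) cv))
      where open +-*-Solver

    away⇒≢0 : ∀ {u} ((δ , _ , N , _) : BoundedAway u) → ∀ n → N ℕ.≤ n → ¬ u n ≡ 0ℚ
    away⇒≢0 {u} (δ , δ>0 , N , δ≤u) n le un≡0 =
      <⇒≱ δ>0 (subst (λ t → δ ≤ ∣ t ∣) un≡0 (δ≤u n le))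

    recip-bounded : ∀ {u} → BoundedAway u → Bounded id (λ n → recip (u n))
    recip-bounded {u} away@(δ , δ>0 , N , δ≤u) = recip δ , recip-pos δ>0 , N , bound
      where
      bound : ∀ n → N ℕ.≤ n → ∣ recip (u n) ∣ ≤ recip δ
      bound n le = ℚₚ.*-cancelˡ-≤-pos δ {{Rat.positive δ>0}}
        (ℚₚ.≤-trans
          (ℚₚ.*-monoʳ-≤-nonNeg ∣ recip (u n) ∣ {{ℚₚ.∣-∣-nonNeg (recip (u n))}} (δ≤u n le))
          (ℚₚ.≤-reflexive
            (≡.trans (≡.sym (ℚₚ.∣p*q∣≡∣p∣*∣q∣ (u n) (recip (u n))))
              (≡.trans (cong ∣_∣ (recip-inverse (u n) (away⇒≢0 {u} away n le)))
                (≡.sym (recip-inverse δ (pos⇒≢0 δ>0)))))))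

    cauchy-recip : ∀ {u} → Cauchy u → BoundedAway u → Cauchy (λ n → recip (u n))
    cauchy-recip {u} cu away@(_ , _ , N , _) = vanishes-eventually (N , eq)
      (vanishes-*ʳ {g = λ (m , n) → r m * r n} (vanishes-neg cu)
        (bounded-* {f = r ∘ proj₁} {g = r ∘ proj₂}
          (bounded-fst (recip-bounded {u} away)) (bounded-snd (recip-bounded {u} away))))
      where
      open +-*-Solver
      r : ℕ → ℚ
      r n = recip (u n)
      eq : ∀ ((m , n) : ℕ × ℕ) → N ℕ.≤ min (m , n) →
           - (u m - u n) * (recip (u m) * recip (u n)) ≡ recip (u m) - recip (u n)
      eq (m , n) le = ≡.trans
        (solve 4 (λ a b r s → :- (a :- b) :* (r :* s) := (b :* s) :* r :- (a :* r) :* s) refl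
          (u m) (u n) (recip (u m)) (recip (u n)))
        (cong₂ _-_
          (≡.trans (cong (_* r m) (recip-inverse (u n) (away⇒≢0 {u} away n (m⊓n-right m n le))))
                   (ℚₚ.*-identityˡ (r m)))
          (≡.trans (cong (_* r n) (recip-inverse (u m) (away⇒≢0 {u} away m (m⊓n-left m n le))))
                   (ℚₚ.*-identityˡ (r n))))

    null-recip : ∀ {u} → BoundedAway u → Null (λ n → u n * recip (u n) - 1ℚ)
    null-recip {u} away@(_ , _ , N , _) = vanishes-eventually (N , λ n le →
      ≡.sym (≡.trans (cong (_- 1ℚ) (recip-inverse (u n) (away⇒≢0 {u} away n le))) (ℚₚ.+-inverseʳ 1ℚ)))
      vanishes-0

    -- A single term exceeding twice the Cauchy tolerance bounds the tail.
    away-from-term : ∀ {u} → Cauchy u → ∀ {ε} → 0ℚ < ε →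
                     ∃ λ N → ∀ n → N ℕ.≤ n → ε + ε ≤ ∣ u n ∣ → BoundedAway u
    away-from-term {u} cu {ε} ε>0 with cu ε ε>0
    ... | N , close = N , λ n N≤n big → ε , ε>0 , N , λ k N≤k →
      ℚₚ.≮⇒≥ λ small → <⇒≱
        (ℚₚ.≤-<-trans (∣a∣≤∣b∣+∣a-b∣ (u n) (u k))
          (ℚₚ.+-mono-< small (close (n , k) (ℕₚ.⊓-glb N≤n N≤k)))) big

    away-resp : ∀ {u v} → Null (λ n → u n - v n) → BoundedAway u → BoundedAway v
    away-resp {u} {v} u~v (δ , δ>0 , M , δ≤u) with u~v (½ * δ) (half-pos δ>0)
    ... | N , close = ½ * δ , half-pos δ>0 , M ℕ.⊔ N , λ n le →
      ℚₚ.≮⇒≥ λ small → <⇒≱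
        (ℚₚ.≤-<-trans (∣a∣≤∣b∣+∣a-b∣ (u n) (v n))
          (subst (∣ v n ∣ + ∣ u n - v n ∣ <_) (half+half δ)
            (ℚₚ.+-mono-< small (close n (⊔-right M N le)))))
        (δ≤u n (⊔-left M N le))

    ¬away-0 : ¬ BoundedAway (λ _ → 0ℚ)
    ¬away-0 (δ , δ>0 , N , δ≤0) = <⇒≱ δ>0 (δ≤0 N ℕₚ.≤-refl)

    away-1 : BoundedAway (λ _ → 1ℚ)
    away-1 = 1ℚ , ℚₚ.positive⁻¹ 1ℚ , 0 , λ _ _ → ℚₚ.≤-refl

    away-+ : ∀ {u v} → Cauchy u → Cauchy v → BoundedAway (λ n → u n + v n) →
             BoundedAway u ⊎ BoundedAway v
    away-+ {u} {v} cu cv (δ , δ>0 , L , δ≤u+v) =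
      let η , η>0 , η+η≡δ = halve δ>0
          ε , ε>0 , ε+ε≡η = halve η>0
          M , u-far       = away-from-term cu ε>0
          N , v-far       = away-from-term cv ε>0
          k               = L ℕ.⊔ (M ℕ.⊔ N)
          k≥M⊔N           = ⊔-right L (M ℕ.⊔ N) ℕₚ.≤-refl
      in Sum.map
           (λ big → u-far k (⊔-left M N k≥M⊔N) (subst (_≤ ∣ u k ∣) (≡.sym ε+ε≡η) big))
           (λ big → v-far k (⊔-right M N k≥M⊔N) (subst (_≤ ∣ v k ∣) (≡.sym ε+ε≡η) big))
           (split (u k) (v k) η+η≡δ (δ≤u+v k (⊔-left L (M ℕ.⊔ N) ℕₚ.≤-refl)))
      where
      split : ∀ a b {η δ} → η + η ≡ δ → δ ≤ ∣ a + b ∣ → η ≤ ∣ a ∣ ⊎ η ≤ ∣ b ∣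
      split a b {η} {δ} η+η≡δ big = decide (η ℚₚ.≤? ∣ a ∣)
        where
        decide : Dec (η ≤ ∣ a ∣) → η ≤ ∣ a ∣ ⊎ η ≤ ∣ b ∣
        decide (yes a-big) = inj₁ a-big
        decide (no a-small) = inj₂ (ℚₚ.≮⇒≥ λ b-small → <⇒≱
          (ℚₚ.≤-<-trans (ℚₚ.∣p+q∣≤∣p∣+∣q∣ a b)
            (subst (∣ a ∣ + ∣ b ∣ <_) η+η≡δ (ℚₚ.+-mono-< (ℚₚ.≰⇒> a-small) b-small))) big)

    away-* : ∀ {u v} → BoundedAway u → BoundedAway v → BoundedAway (λ n → u n * v n)
    away-* {u} {v} (α , α>0 , M , α≤u) (β , β>0 , N , β≤v) =
      α * β , *-pos α>0 β>0 , M ℕ.⊔ N , λ n le →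
        subst (α * β ≤_) (≡.sym (ℚₚ.∣p*q∣≡∣p∣*∣q∣ (u n) (v n)))
          (*-mono-≤ (ℚₚ.<⇒≤ α>0) (ℚₚ.0≤∣p∣ (v n)) (α≤u n (⊔-left M N le)) (β≤v n (⊔-right M N le)))

    away-factor : ∀ {u v} → Cauchy v → BoundedAway (λ n → u n * v n) → BoundedAway u
    away-factor {u} {v} cv (δ , δ>0 , M , δ≤uv) =
      let B , B>0 , N , v≤B = cauchy⇒bounded cv
      in δ * recip B , *-pos δ>0 (recip-pos B>0) , M ℕ.⊔ N , λ n le →
           divide B>0 (≤-abs-* (u n) (v n) (δ≤uv n (⊔-left M N le)) (v≤B n (⊔-right M N le)))
      where
      ≤-abs-* : ∀ a b {δ B} → δ ≤ ∣ a * b ∣ → ∣ b ∣ ≤ B → δ ≤ ∣ a ∣ * B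
      ≤-abs-* a b δ≤ab b≤B = ℚₚ.≤-trans δ≤ab
        (ℚₚ.≤-trans (ℚₚ.≤-reflexive (ℚₚ.∣p*q∣≡∣p∣*∣q∣ a b))
          (ℚₚ.*-monoˡ-≤-nonNeg ∣ a ∣ {{ℚₚ.∣-∣-nonNeg a}} b≤B))
      divide : ∀ {B δ a} → 0ℚ < B → δ ≤ a * B → δ * recip B ≤ a
      divide {B} {δ} {a} B>0 δ≤aB = ℚₚ.*-cancelʳ-≤-pos B {{Rat.positive B>0}}
        (subst (_≤ a * B) (≡.sym (*-recip-cancel δ B>0)) δ≤aB)

    ¬away⇒null : ∀ {u} → Cauchy u → ¬ BoundedAway u → Null u
    ¬away⇒null {u} cu ¬away ε ε>0 =
      let η , η>0 , η+η≡ε = halve ε>0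
          N , far         = away-from-term cu η>0
      in N , λ n N≤n → ℚₚ.≰⇒> λ big → ¬away (far n N≤n (subst (_≤ ∣ u n ∣) (≡.sym η+η≡ε) big))

    away-sumOfSquares : (u v : ℕ → ℚ) → BoundedAway u → BoundedAway (λ n → u n * u n + v n * v n)
    away-sumOfSquares u v u-away =
      let δ , δ>0 , N , δ≤uu = away-* {u} {u} u-away u-away
      in δ , δ>0 , N , λ n le → ℚₚ.≤-trans (δ≤uu n le) (compare (u n) (v n))
      where
      sq≥0 : ∀ q → 0ℚ ≤ q * q
      sq≥0 q with ℚₚ.≤-total 0ℚ q
      ... | inj₁ q≥0 = subst (_≤ q * q) (ℚₚ.*-zeroʳ q) (ℚₚ.*-monoˡ-≤-nonNeg q {{Rat.nonNegative q≥0}} q≥0)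
      ... | inj₂ q≤0 = subst (_≤ q * q) (ℚₚ.*-zeroʳ q) (ℚₚ.*-monoˡ-≤-nonPos q {{Rat.nonPositive q≤0}} q≤0)
      compare : ∀ a b → ∣ a * a ∣ ≤ ∣ a * a + b * b ∣
      compare a b = ≡.subst₂ _≤_
        (≡.sym (ℚₚ.0≤p⇒∣p∣≡p (sq≥0 a)))
        (≡.sym (ℚₚ.0≤p⇒∣p∣≡p (ℚₚ.≤-trans (sq≥0 a) a²≤a²+b²)))
        a²≤a²+b²
        where
        a²≤a²+b² : a * a ≤ a * a + b * b
        a²≤a²+b² = subst (_≤ a * a + b * b) (ℚₚ.+-identityʳ (a * a)) (ℚₚ.+-monoʳ-≤ (a * a) (sq≥0 b))

record ℝ : Set where
  constructor mkℝ
  field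
    approx : ℕ → ℚ
    cauchy : CauchyReals.Cauchy approx

module Real where
  open CauchyReals
  open ℝ
  open +-*-Solver

  infix  4 _≈_
  infixl 6 _+_
  infixl 7 _*_
  infix  8 -_

  record _≈_ (x y : ℝ) : Set where
    constructor mk≈
    field null : Null (λ n → approx x n Rat.- approx y n)
  open _≈_

  _+_ _*_ : ℝ → ℝ → ℝ
  x + y = mkℝ (λ n → approx x n Rat.+ approx y n) (cauchy-+ {approx x} {approx y} (cauchy x) (cauchy y))
  x * y = mkℝ (λ n → approx x n Rat.* approx y n) (cauchy-* {approx x} {approx y} (cauchy x) (cauchy y))

  -_ : ℝ → ℝ
  - x = mkℝ (λ n → Rat.- approx x n) (cauchy-neg {approx x} (cauchy x))

  fromℚ : ℚ → ℝ
  fromℚ q = mkℝ (λ _ → q) (cauchy-const q)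

  0ℝ 1ℝ : ℝ
  0ℝ = fromℚ 0ℚ
  1ℝ = fromℚ 1ℚ

  abstract
    private
      pointwise : ∀ {x y} → (∀ n → approx x n ≡ approx y n) → x ≈ y
      pointwise {x} {y} eq = mk≈ (vanishes-ext {f = λ _ → 0ℚ}
        (λ n → ≡.sym (≡.trans (≡.cong (Rat._- approx y n) (eq n)) (ℚₚ.+-inverseʳ (approx y n))))
        vanishes-0)

    isCommutativeRing : IsCommutativeRing _≈_ _+_ _*_ -_ 0ℝ 1ℝ
    isCommutativeRing = CommutativeRingAxioms.isCommutativeRing record
      { isEquivalence = record
        { refl  = pointwise (λ _ → ≡.refl)
        ; sym   = λ {x} {y} (mk≈ p) → mk≈ (vanishes-ext
            (λ n → solve 2 (λ a b → :- (a :- b) := b :- a) ≡.refl (approx x n) (approx y n))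
            (vanishes-neg p))
        ; trans = λ {x} {y} {z} (mk≈ p) (mk≈ q) → mk≈ (vanishes-ext
            (λ n → solve 3 (λ a b c → (a :- b) :+ (b :- c) := a :- c) ≡.refl (approx x n) (approx y n) (approx z n))
            (vanishes-+ p q))
        }
      ; +-cong = λ {x} {x′} {y} {y′} (mk≈ p) (mk≈ q) → mk≈ (vanishes-ext
          (λ n → solve 4 (λ a b c d → (a :- b) :+ (c :- d) := (a :+ c) :- (b :+ d)) ≡.refl
            (approx x n) (approx x′ n) (approx y n) (approx y′ n))
          (vanishes-+ p q))
      ; +-assoc = λ x y z → pointwise λ n → ℚₚ.+-assoc (approx x n) (approx y n) (approx z n)
      ; +-comm = λ x y → pointwise λ n → ℚₚ.+-comm (approx x n) (approx y n)
      ; +-identityˡ = λ x → pointwise λ n → ℚₚ.+-identityˡ (approx x n)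
      ; -‿cong = λ {x} {y} (mk≈ p) → mk≈ (vanishes-ext
          (λ n → solve 2 (λ a b → :- (a :- b) := (:- a) :- (:- b)) ≡.refl (approx x n) (approx y n))
          (vanishes-neg p))
      ; -‿inverseˡ = λ x → pointwise λ n → ℚₚ.+-inverseˡ (approx x n)
      ; *-cong = λ {x} {x′} {y} {y′} (mk≈ p) (mk≈ q) → mk≈ (vanishes-ext
          (λ n → solve 4 (λ a b c d → (a :- b) :* c :+ b :* (c :- d) := a :* c :- b :* d) ≡.refl
            (approx x n) (approx x′ n) (approx y n) (approx y′ n))
          (vanishes-+ {f = λ n → (approx x n Rat.- approx x′ n) Rat.* approx y n}
                      {g = λ n → approx x′ n Rat.* (approx y n Rat.- approx y′ n)}
            (vanishes-*ʳ {g = approx y} p (cauchy⇒bounded (cauchy y)))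
            (vanishes-*ˡ {f = approx x′} (cauchy⇒bounded (cauchy x′)) q)))
      ; *-assoc = λ x y z → pointwise λ n → ℚₚ.*-assoc (approx x n) (approx y n) (approx z n)
      ; *-comm = λ x y → pointwise λ n → ℚₚ.*-comm (approx x n) (approx y n)
      ; *-identityˡ = λ x → pointwise λ n → ℚₚ.*-identityˡ (approx x n)
      ; distribʳ = λ x y z → pointwise λ n → ℚₚ.*-distribʳ-+ (approx x n) (approx y n) (approx z n)
      }

  commutativeRing : CommutativeRing 0ℓ 0ℓ
  commutativeRing = record { isCommutativeRing = isCommutativeRing }

  record NonZero (x : ℝ) : Set where
    constructor mkNonZero
    field away : BoundedAway (approx x)
  open NonZero

  abstract
    private
      null-0 : ∀ {u} → Null u → Null (λ n → u n Rat.- 0ℚ)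
      null-0 {u} = vanishes-ext (λ n → ≡.sym (ℚₚ.+-identityʳ (u n)))

  domain : ApartnessDomain 0ℓ 0ℓ 0ℓ
  domain = record
    { commutativeRing = commutativeRing
    ; NonZero         = NonZero
    ; nonZero-resp    = λ {x} {y} (mk≈ p) (mkNonZero a) → mkNonZero (away-resp {approx x} {approx y} p a)
    ; ¬nonZero-0      = λ (mkNonZero a) → ¬away-0 a
    ; nonZero-1       = mkNonZero away-1
    ; nonZero-+       = λ {x} {y} (mkNonZero a) → Sum.map mkNonZero mkNonZero
        (away-+ {approx x} {approx y} (cauchy x) (cauchy y) a)
    ; nonZero-*       = λ {x} {y} (mkNonZero a) (mkNonZero b) →
        mkNonZero (away-* {approx x} {approx y} a b)
    ; nonZero-factor  = λ {x} {y} (mkNonZero a) →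
        mkNonZero (away-factor {approx x} {approx y} (cauchy y) a)
    ; ¬nonZero⇒0      = λ {x} ¬nz → mk≈ (null-0 (¬away⇒null (cauchy x) λ a → ¬nz (mkNonZero a)))
    }

  inverse : ∀ x → NonZero x → ∃ λ y → x * y ≈ 1ℝ
  inverse x (mkNonZero a) =
    mkℝ (λ n → recip (approx x n)) (cauchy-recip {approx x} (cauchy x) a) ,
    mk≈ (null-recip {approx x} a)

  abstract
    nonZero-sumOfSquares : ∀ x y → NonZero x → NonZero (x * x + y * y)
    nonZero-sumOfSquares x y (mkNonZero a) = mkNonZero (away-sumOfSquares (approx x) (approx y) a)

record FormallyRealField c ℓ ν : Set (lsuc (c ⊔ ℓ ⊔ ν)) where
  field
    domain : ApartnessDomain c ℓ ν
  open ApartnessDomain domain public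
  field
    inverse              : ∀ x → NonZero x → ∃ λ y → x * y ≈ 1#
    nonZero-sumOfSquares : ∀ x y → NonZero x → NonZero (x * x + y * y)

module Complexification {c ℓ ν} (F : FormallyRealField c ℓ ν) where
  private
    module R = FormallyRealField F
    module R′ = DomainProperties R.domain
  open SemiringSolver R.commutativeSemiring
  open RingProperties R.ring using (-1*x≈-x; -0#≈0#; -‿distribˡ-*; -‿distribʳ-*; -‿involutive)

  infix 6 _+i_
  record Carrier : Set c where
    constructor _+i_
    field
      re im : R.Carrier
  open Carrier

  infix  4 _≈_
  infixl 6 _+_
  infixl 7 _*_
  infix  8 -_

  record _≈_ (x y : Carrier) : Set ℓ where
    constructor mk≈
    field
      re-≈ : re x R.≈ re y
      im-≈ : im x R.≈ im y

  _+_ _*_ : Carrier → Carrier → Carrier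
  (a +i b) + (c +i d) = (a R.+ c) +i (b R.+ d)
  (a +i b) * (c +i d) = (a R.* c R.- b R.* d) +i (a R.* d R.+ b R.* c)

  -_ : Carrier → Carrier
  - (a +i b) = (R.- a) +i (R.- b)

  0# 1# : Carrier
  0# = R.0# +i R.0#
  1# = R.1# +i R.0#

  NonZero : Carrier → Set ν
  NonZero (a +i b) = R.NonZero a ⊎ R.NonZero b

  abstract
    private
      -- The semiring solver knows no negation; it is given −1 as a variable.
      sub : ∀ x y → x R.- y R.≈ x R.+ (R.- R.1#) R.* y
      sub x y = R.+-congˡ (R.sym (-1*x≈-x y))

      assoc-re : ∀ a b c d e f →
        (a R.* c R.- b R.* d) R.* e R.- (a R.* d R.+ b R.* c) R.* f R.≈
        a R.* (c R.* e R.- d R.* f) R.- b R.* (c R.* f R.+ d R.* e)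
      assoc-re a b c d e f = begin
        (a R.* c R.- b R.* d) R.* e R.- (a R.* d R.+ b R.* c) R.* f
          ≈⟨ sub _ _ ⟩
        (a R.* c R.- b R.* d) R.* e R.+ j R.* ((a R.* d R.+ b R.* c) R.* f)
          ≈⟨ R.+-congʳ (R.*-congʳ (sub _ _)) ⟩
        (a R.* c R.+ j R.* (b R.* d)) R.* e R.+ j R.* ((a R.* d R.+ b R.* c) R.* f)
          ≈⟨ solve 7 (λ a b c d e f j →
               (a :* c :+ j :* (b :* d)) :* e :+ j :* ((a :* d :+ b :* c) :* f) :=
               a :* (c :* e :+ j :* (d :* f)) :+ j :* (b :* (c :* f :+ d :* e))) R.refl a b c d e f j ⟩
        a R.* (c R.* e R.+ j R.* (d R.* f)) R.+ j R.* (b R.* (c R.* f R.+ d R.* e))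
          ≈⟨ R.+-congʳ (R.*-congˡ (sub _ _)) ⟨
        a R.* (c R.* e R.- d R.* f) R.+ j R.* (b R.* (c R.* f R.+ d R.* e))
          ≈⟨ sub _ _ ⟨
        a R.* (c R.* e R.- d R.* f) R.- b R.* (c R.* f R.+ d R.* e) ∎
        where
        open SetoidReasoning R.setoid
        j : R.Carrier
        j = R.- R.1#

      assoc-im : ∀ a b c d e f →
        (a R.* c R.- b R.* d) R.* f R.+ (a R.* d R.+ b R.* c) R.* e R.≈
        a R.* (c R.* f R.+ d R.* e) R.+ b R.* (c R.* e R.- d R.* f)
      assoc-im a b c d e f = begin
        (a R.* c R.- b R.* d) R.* f R.+ (a R.* d R.+ b R.* c) R.* e
          ≈⟨ R.+-congʳ (R.*-congʳ (sub _ _)) ⟩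
        (a R.* c R.+ j R.* (b R.* d)) R.* f R.+ (a R.* d R.+ b R.* c) R.* e
          ≈⟨ solve 7 (λ a b c d e f j →
               (a :* c :+ j :* (b :* d)) :* f :+ (a :* d :+ b :* c) :* e :=
               a :* (c :* f :+ d :* e) :+ b :* (c :* e :+ j :* (d :* f))) R.refl a b c d e f j ⟩
        a R.* (c R.* f R.+ d R.* e) R.+ b R.* (c R.* e R.+ j R.* (d R.* f))
          ≈⟨ R.+-congˡ (R.*-congˡ (sub _ _)) ⟨
        a R.* (c R.* f R.+ d R.* e) R.+ b R.* (c R.* e R.- d R.* f) ∎
        where
        open SetoidReasoning R.setoid
        j : R.Carrier
        j = R.- R.1#

      distribʳ-re : ∀ a b c d e f →
        (c R.+ e) R.* a R.- (d R.+ f) R.* b R.≈ (c R.* a R.- d R.* b) R.+ (e R.* a R.- f R.* b)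
      distribʳ-re a b c d e f = begin
        (c R.+ e) R.* a R.- (d R.+ f) R.* b
          ≈⟨ sub _ _ ⟩
        (c R.+ e) R.* a R.+ j R.* ((d R.+ f) R.* b)
          ≈⟨ solve 7 (λ a b c d e f j →
               (c :+ e) :* a :+ j :* ((d :+ f) :* b) :=
               (c :* a :+ j :* (d :* b)) :+ (e :* a :+ j :* (f :* b))) R.refl a b c d e f j ⟩
        (c R.* a R.+ j R.* (d R.* b)) R.+ (e R.* a R.+ j R.* (f R.* b))
          ≈⟨ R.+-cong (sub _ _) (sub _ _) ⟨
        (c R.* a R.- d R.* b) R.+ (e R.* a R.- f R.* b) ∎
        where
        open SetoidReasoning R.setoid
        j : R.Carrier
        j = R.- R.1#

      x-0≈x : ∀ x → x R.- R.0# R.≈ x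
      x-0≈x x = R.trans (R.+-congˡ -0#≈0#) (R.+-identityʳ x)

    isCommutativeRing : IsCommutativeRing _≈_ _+_ _*_ -_ 0# 1#
    isCommutativeRing = CommutativeRingAxioms.isCommutativeRing record
      { isEquivalence = record
        { refl  = mk≈ R.refl R.refl
        ; sym   = λ (mk≈ p q) → mk≈ (R.sym p) (R.sym q)
        ; trans = λ (mk≈ p q) (mk≈ r s) → mk≈ (R.trans p r) (R.trans q s)
        }
      ; +-cong = λ (mk≈ p q) (mk≈ r s) → mk≈ (R.+-cong p r) (R.+-cong q s)
      ; +-assoc = λ (a +i b) (c +i d) (e +i f) → mk≈ (R.+-assoc a c e) (R.+-assoc b d f)
      ; +-comm = λ (a +i b) (c +i d) → mk≈ (R.+-comm a c) (R.+-comm b d)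
      ; +-identityˡ = λ (a +i b) → mk≈ (R.+-identityˡ a) (R.+-identityˡ b)
      ; -‿cong = λ (mk≈ p q) → mk≈ (R.-‿cong p) (R.-‿cong q)
      ; -‿inverseˡ = λ (a +i b) → mk≈ (R.-‿inverseˡ a) (R.-‿inverseˡ b)
      ; *-cong = λ (mk≈ p q) (mk≈ r s) → mk≈
          (R.+-cong (R.*-cong p r) (R.-‿cong (R.*-cong q s)))
          (R.+-cong (R.*-cong p s) (R.*-cong q r))
      ; *-assoc = λ (a +i b) (c +i d) (e +i f) → mk≈ (assoc-re a b c d e f) (assoc-im a b c d e f)
      ; *-comm = λ (a +i b) (c +i d) → mk≈
          (R.+-cong (R.*-comm a c) (R.-‿cong (R.*-comm b d)))
          (R.trans (R.+-comm (a R.* d) (b R.* c)) (R.+-cong (R.*-comm b c) (R.*-comm a d)))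
      ; *-identityˡ = λ (a +i b) → mk≈
          (R.trans (R.+-cong (R.*-identityˡ a) (R.-‿cong (R.zeroˡ b))) (x-0≈x a))
          (R.trans (R.+-cong (R.*-identityˡ b) (R.zeroˡ a)) (R.+-identityʳ b))
      ; distribʳ = λ (a +i b) (c +i d) (e +i f) → mk≈
          (distribʳ-re a b c d e f)
          (solve 6 (λ a b c d e f → (c :+ e) :* b :+ (d :+ f) :* a :=
             (c :* b :+ d :* a) :+ (e :* b :+ f :* a)) R.refl a b c d e f)
      }

  commutativeRing : CommutativeRing c ℓ
  commutativeRing = record { isCommutativeRing = isCommutativeRing }

  private
    module C = CommutativeRing commutativeRing

  -- x times its conjugate
  norm : Carrier → R.Carrier
  norm (a +i b) = a R.* a R.+ b R.* b

  private abstract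
    nonZero-norm : ∀ x → NonZero x → R.NonZero (norm x)
    nonZero-norm (a +i b) (inj₁ a≠0) = R.nonZero-sumOfSquares a b a≠0
    nonZero-norm (a +i b) (inj₂ b≠0) =
      R.nonZero-resp (R.+-comm (b R.* b) (a R.* a)) (R.nonZero-sumOfSquares b a b≠0)

  private abstract
    nonZero-resp : ∀ {x y} → x ≈ y → NonZero x → NonZero y
    nonZero-resp (mk≈ p q) = Sum.map (R.nonZero-resp p) (R.nonZero-resp q)

    nonZero-factor : ∀ {x y} → NonZero (x * y) → NonZero x
    nonZero-factor {a +i b} {c +i d} (inj₁ nz) =
      Sum.map R.nonZero-factor (R.nonZero-factor ∘ R′.nonZero-neg⁻¹) (R.nonZero-+ nz)
    nonZero-factor {a +i b} {c +i d} (inj₂ nz) =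
      Sum.map R.nonZero-factor R.nonZero-factor (R.nonZero-+ nz)

  inverse : ∀ x → NonZero x → ∃ λ y → x * y ≈ 1#
  inverse x@(a +i b) nz = let r , nr≈1 = R.inverse (norm x) (nonZero-norm x nz) in
    (a R.* r) +i (R.- (b R.* r)) , isInverse r nr≈1
    where
    abstract
      isInverse : ∀ r → norm x R.* r R.≈ R.1# → x * ((a R.* r) +i (R.- (b R.* r))) ≈ 1#
      isInverse r nr≈1 = mk≈
        (begin
          a R.* (a R.* r) R.- b R.* (R.- (b R.* r))
            ≈⟨ R.+-congˡ (R.-‿cong (-‿distribʳ-* b (b R.* r))) ⟨
          a R.* (a R.* r) R.- (R.- (b R.* (b R.* r)))
            ≈⟨ R.+-congˡ (-‿involutive _) ⟩
          a R.* (a R.* r) R.+ b R.* (b R.* r)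
            ≈⟨ solve 3 (λ a b r → a :* (a :* r) :+ b :* (b :* r) := (a :* a :+ b :* b) :* r) R.refl a b r ⟩
          norm x R.* r
            ≈⟨ nr≈1 ⟩
          R.1# ∎)
        (begin
          a R.* (R.- (b R.* r)) R.+ b R.* (a R.* r)
            ≈⟨ R.+-congʳ (-‿distribʳ-* a (b R.* r)) ⟨
          R.- (a R.* (b R.* r)) R.+ b R.* (a R.* r)
            ≈⟨ R.+-congˡ (solve 3 (λ a b r → b :* (a :* r) := a :* (b :* r)) R.refl a b r) ⟩
          R.- (a R.* (b R.* r)) R.+ a R.* (b R.* r)
            ≈⟨ R.-‿inverseˡ _ ⟩
          R.0# ∎)
        where open SetoidReasoning R.setoid

  private abstract
    nonZero-1 : NonZero 1#
    nonZero-1 = inj₁ R.nonZero-1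

    nonZero-+ : ∀ {x y} → NonZero (x + y) → NonZero x ⊎ NonZero y
    nonZero-+ (inj₁ nz) = Sum.map inj₁ inj₁ (R.nonZero-+ nz)
    nonZero-+ (inj₂ nz) = Sum.map inj₂ inj₂ (R.nonZero-+ nz)

    nonZero-* : ∀ {x y} → NonZero x → NonZero y → NonZero (x * y)
    nonZero-* {x} {y} x≠0 y≠0 = let z , xz≈1 = inverse x x≠0 in
      nonZero-factor {y = z} (nonZero-resp (C.sym (eq z xz≈1)) y≠0)
      where
      open SetoidReasoning C.setoid
      eq : ∀ z → x * z ≈ 1# → x * y * z ≈ y
      eq z xz≈1 = begin
        x * y * z    ≈⟨ C.*-congʳ (C.*-comm x y) ⟩
        y * x * z    ≈⟨ C.*-assoc y x z ⟩
        y * (x * z)  ≈⟨ C.*-congˡ xz≈1 ⟩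
        y * 1#       ≈⟨ C.*-identityʳ y ⟩
        y            ∎

  domain : ApartnessDomain c ℓ ν
  domain = record
    { commutativeRing = commutativeRing
    ; NonZero         = NonZero
    ; nonZero-resp    = nonZero-resp
    ; ¬nonZero-0      = [ R.¬nonZero-0 , R.¬nonZero-0 ]′
    ; nonZero-1       = nonZero-1
    ; nonZero-+       = nonZero-+
    ; nonZero-*       = nonZero-*
    ; nonZero-factor  = nonZero-factor
    ; ¬nonZero⇒0      = λ ¬nz → mk≈ (R.¬nonZero⇒0 (¬nz ∘ inj₁)) (R.¬nonZero⇒0 (¬nz ∘ inj₂))
    }

formallyRealField : FormallyRealField 0ℓ 0ℓ 0ℓ
formallyRealField = record
  { domain               = Real.domain
  ; inverse              = Real.inverse
  ; nonZero-sumOfSquares = Real.nonZero-sumOfSquares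
  }

module Complex = Complexification formallyRealField

ℂ : Set
ℂ = Complex.Carrier

module Polynomial {c ℓ} (R : CommutativeRing c ℓ) where
  private module R = CommutativeRing R
  open RingProperties R.ring using (-0#≈0#)

  -- Coefficients in order of increasing degree; trailing zeros are allowed.
  Poly : Set c
  Poly = List R.Carrier

  coeff : Poly → ℕ → R.Carrier
  coeff []      n       = R.0#
  coeff (a ∷ p) zero    = a
  coeff (a ∷ p) (suc n) = coeff p n

  infix  4 _≈_
  infixl 6 _+_
  infixr 7 _·_
  infixl 7 _*_
  infix  8 -_

  record _≈_ (p q : Poly) : Set ℓ where
    constructor mk≈
    field coeff-≈ : ∀ n → coeff p n R.≈ coeff q n
  open _≈_

  _+_ : Poly → Poly → Poly
  []      + q       = q
  (a ∷ p) + []      = a ∷ p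
  (a ∷ p) + (b ∷ q) = (a R.+ b) ∷ (p + q)

  _·_ : R.Carrier → Poly → Poly
  a · p = List.map (a R.*_) p

  _*_ : Poly → Poly → Poly
  []      * q = []
  (a ∷ p) * q = a · q + (R.0# ∷ p * q)

  -_ : Poly → Poly
  - p = List.map (λ a → R.- a) p

  const : R.Carrier → Poly
  const a = a ∷ []

  0ₚ 1ₚ X : Poly
  0ₚ = []
  1ₚ = const R.1#
  X  = R.0# ∷ R.1# ∷ []

  abstract
    coeff-+ : ∀ p q n → coeff (p + q) n R.≈ coeff p n R.+ coeff q n
    coeff-+ []      q       n       = R.sym (R.+-identityˡ (coeff q n))
    coeff-+ (a ∷ p) []      n       = R.sym (R.+-identityʳ (coeff (a ∷ p) n))
    coeff-+ (a ∷ p) (b ∷ q) zero    = R.refl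
    coeff-+ (a ∷ p) (b ∷ q) (suc n) = coeff-+ p q n

    coeff-· : ∀ a p n → coeff (a · p) n R.≈ a R.* coeff p n
    coeff-· a []      n       = R.sym (R.zeroʳ a)
    coeff-· a (b ∷ p) zero    = R.refl
    coeff-· a (b ∷ p) (suc n) = coeff-· a p n

    coeff-neg : ∀ p n → coeff (- p) n R.≈ R.- coeff p n
    coeff-neg []      n       = R.sym -0#≈0#
    coeff-neg (a ∷ p) zero    = R.refl
    coeff-neg (a ∷ p) (suc n) = coeff-neg p n

    private
      ≈-refl : ∀ {p} → p ≈ p
      ≈-refl = mk≈ λ _ → R.refl

      ≈-sym : ∀ {p q} → p ≈ q → q ≈ p
      ≈-sym (mk≈ p≈q) = mk≈ λ n → R.sym (p≈q n)

      ≈-trans : ∀ {p q r} → p ≈ q → q ≈ r → p ≈ r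
      ≈-trans (mk≈ p≈q) (mk≈ q≈r) = mk≈ λ n → R.trans (p≈q n) (q≈r n)

      via : ∀ {p q} {f g : ℕ → R.Carrier} → (∀ n → coeff p n R.≈ f n) → (∀ n → coeff q n R.≈ g n) →
            (∀ n → f n R.≈ g n) → p ≈ q
      via p≈f q≈g f≈g = mk≈ λ n → R.trans (p≈f n) (R.trans (f≈g n) (R.sym (q≈g n)))

      +-cong : ∀ {p p′ q q′} → p ≈ p′ → q ≈ q′ → p + q ≈ p′ + q′
      +-cong {p} {p′} {q} {q′} (mk≈ e) (mk≈ f) =
        via (coeff-+ p q) (coeff-+ p′ q′) λ n → R.+-cong (e n) (f n)

      +-assoc : ∀ p q r → (p + q) + r ≈ p + (q + r)
      +-assoc p q r = via
        (λ n → R.trans (coeff-+ (p + q) r n) (R.+-congʳ (coeff-+ p q n)))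
        (λ n → R.trans (coeff-+ p (q + r) n) (R.+-congˡ (coeff-+ q r n)))
        (λ n → R.+-assoc (coeff p n) (coeff q n) (coeff r n))

      +-comm : ∀ p q → p + q ≈ q + p
      +-comm p q = via (coeff-+ p q) (coeff-+ q p) λ n → R.+-comm (coeff p n) (coeff q n)

      +-identityʳ : ∀ p → p + [] ≈ p
      +-identityʳ p = +-comm p []

      neg-cong : ∀ {p q} → p ≈ q → - p ≈ - q
      neg-cong {p} {q} (mk≈ e) = via (coeff-neg p) (coeff-neg q) λ n → R.-‿cong (e n)

      neg-inverseˡ : ∀ p → - p + p ≈ []
      neg-inverseˡ p = via
        (λ n → R.trans (coeff-+ (- p) p n) (R.+-congʳ (coeff-neg p n)))
        (λ _ → R.refl)
        (λ n → R.-‿inverseˡ (coeff p n))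

      ∷-cong : ∀ {a b p q} → a R.≈ b → p ≈ q → a ∷ p ≈ b ∷ q
      ∷-cong a≈b (mk≈ p≈q) = mk≈ λ { zero → a≈b ; (suc n) → p≈q n }

      0∷[] : R.0# ∷ [] ≈ []
      0∷[] = mk≈ λ { zero → R.refl ; (suc n) → R.refl }

      ·-cong : ∀ {a b p q} → a R.≈ b → p ≈ q → a · p ≈ b · q
      ·-cong {a} {b} {p} {q} a≈b (mk≈ e) =
        via (coeff-· a p) (coeff-· b q) λ n → R.*-cong a≈b (e n)

      ·-distribˡ : ∀ a p q → a · (p + q) ≈ a · p + a · q
      ·-distribˡ a p q = via
        (λ n → R.trans (coeff-· a (p + q) n) (R.*-congˡ (coeff-+ p q n)))
        (λ n → R.trans (coeff-+ (a · p) (a · q) n) (R.+-cong (coeff-· a p n) (coeff-· a q n)))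
        (λ n → R.distribˡ a (coeff p n) (coeff q n))

      ·-distribʳ : ∀ a b p → (a R.+ b) · p ≈ a · p + b · p
      ·-distribʳ a b p = via
        (coeff-· (a R.+ b) p)
        (λ n → R.trans (coeff-+ (a · p) (b · p) n) (R.+-cong (coeff-· a p n) (coeff-· b p n)))
        (λ n → R.distribʳ (coeff p n) a b)

      ·-assoc : ∀ a b p → (a R.* b) · p ≈ a · b · p
      ·-assoc a b p = via
        (coeff-· (a R.* b) p)
        (λ n → R.trans (coeff-· a (b · p) n) (R.*-congˡ (coeff-· b p n)))
        (λ n → R.*-assoc a b (coeff p n))

      0·p≈0 : ∀ p → R.0# · p ≈ []
      0·p≈0 p = via (coeff-· R.0# p) (λ _ → R.refl) λ n → R.zeroˡ (coeff p n)

      1·p≈p : ∀ p → R.1# · p ≈ p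
      1·p≈p p = via (coeff-· R.1# p) (λ _ → R.refl) λ n → R.*-identityˡ (coeff p n)

    private
      setoid : Setoid c ℓ
      setoid = record
        { Carrier = Poly
        ; _≈_ = _≈_
        ; isEquivalence = record { refl = ≈-refl ; sym = ≈-sym ; trans = ≈-trans }
        }

      open SetoidReasoning setoid

      interchange : ∀ p q r s → (p + q) + (r + s) ≈ (p + r) + (q + s)
      interchange p q r s = via
        (λ n → R.trans (coeff-+ (p + q) (r + s) n) (R.+-cong (coeff-+ p q n) (coeff-+ r s n)))
        (λ n → R.trans (coeff-+ (p + r) (q + s) n) (R.+-cong (coeff-+ p r n) (coeff-+ q s n)))
        (λ n → medial (coeff p n) (coeff q n) (coeff r n) (coeff s n))
        where open CommutativeSemigroupProperties R.+-commutativeSemigroup renaming (interchange to medial)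

      exchange : ∀ p q r → p + (q + r) ≈ q + (p + r)
      exchange p q r = begin
        p + (q + r)  ≈⟨ +-assoc p q r ⟨
        (p + q) + r  ≈⟨ +-cong (+-comm p q) ≈-refl ⟩
        (q + p) + r  ≈⟨ +-assoc q p r ⟩
        q + (p + r)  ∎

      *-zeroʳ : ∀ p → p * [] ≈ []
      *-zeroʳ []      = ≈-refl
      *-zeroʳ (a ∷ p) = ≈-trans (∷-cong R.refl (*-zeroʳ p)) 0∷[]

      *-∷ : ∀ p b q → p * (b ∷ q) ≈ b · p + (R.0# ∷ p * q)
      *-∷ []      b q = ≈-sym 0∷[]
      *-∷ (a ∷ p) b q = ∷-cong (R.+-congʳ (R.*-comm a b))
        (≈-trans (+-cong ≈-refl (*-∷ p b q)) (exchange (a · q) (b · p) (R.0# ∷ p * q)))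

      *-comm : ∀ p q → p * q ≈ q * p
      *-comm []      q = ≈-sym (*-zeroʳ q)
      *-comm (a ∷ p) q = ≈-trans (+-cong ≈-refl (∷-cong R.refl (*-comm p q))) (≈-sym (*-∷ q a p))

      *-congˡ : ∀ p {q q′} → q ≈ q′ → p * q ≈ p * q′
      *-congˡ []      e = ≈-refl
      *-congˡ (a ∷ p) e = +-cong (·-cong R.refl e) (∷-cong R.refl (*-congˡ p e))

      *-cong : ∀ {p p′ q q′} → p ≈ p′ → q ≈ q′ → p * q ≈ p′ * q′
      *-cong {p} {p′} {q} {q′} e f = begin
        p * q    ≈⟨ *-congˡ p f ⟩
        p * q′   ≈⟨ *-comm p q′ ⟩
        q′ * p   ≈⟨ *-congˡ q′ e ⟩
        q′ * p′  ≈⟨ *-comm q′ p′ ⟩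
        p′ * q′  ∎

      *-distribʳ : ∀ r p q → (p + q) * r ≈ p * r + q * r
      *-distribʳ r []      q       = ≈-refl
      *-distribʳ r (a ∷ p) []      = ≈-sym (+-identityʳ ((a ∷ p) * r))
      *-distribʳ r (a ∷ p) (b ∷ q) = begin
        (a R.+ b) · r + (R.0# ∷ (p + q) * r)
          ≈⟨ +-cong (·-distribʳ a b r) (∷-cong (R.sym (R.+-identityʳ R.0#)) (*-distribʳ r p q)) ⟩
        (a · r + b · r) + ((R.0# ∷ p * r) + (R.0# ∷ q * r))
          ≈⟨ interchange (a · r) (b · r) _ _ ⟩
        (a · r + (R.0# ∷ p * r)) + (b · r + (R.0# ∷ q * r)) ∎

      shift-* : ∀ p q → (R.0# ∷ p) * q ≈ R.0# ∷ p * q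
      shift-* p q = +-cong (0·p≈0 q) ≈-refl

      ·-* : ∀ a p q → (a · p) * q ≈ a · (p * q)
      ·-* a []      q = ≈-refl
      ·-* a (b ∷ p) q = begin
        (a R.* b) · q + (R.0# ∷ (a · p) * q)
          ≈⟨ +-cong (·-assoc a b q) (∷-cong (R.sym (R.zeroʳ a)) (·-* a p q)) ⟩
        a · b · q + a · (R.0# ∷ p * q)
          ≈⟨ ·-distribˡ a (b · q) (R.0# ∷ p * q) ⟨
        a · (b · q + (R.0# ∷ p * q)) ∎

      *-assoc : ∀ p q r → (p * q) * r ≈ p * (q * r)
      *-assoc []      q r = ≈-refl
      *-assoc (a ∷ p) q r = begin
        (a · q + (R.0# ∷ p * q)) * r
          ≈⟨ *-distribʳ r (a · q) (R.0# ∷ p * q) ⟩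
        (a · q) * r + (R.0# ∷ p * q) * r
          ≈⟨ +-cong (·-* a q r) (shift-* (p * q) r) ⟩
        a · (q * r) + (R.0# ∷ (p * q) * r)
          ≈⟨ +-cong ≈-refl (∷-cong R.refl (*-assoc p q r)) ⟩
        a · (q * r) + (R.0# ∷ p * (q * r)) ∎

      *-identityˡ : ∀ p → 1ₚ * p ≈ p
      *-identityˡ p = ≈-trans (+-cong (1·p≈p p) 0∷[]) (+-identityʳ p)

    isCommutativeRing : IsCommutativeRing _≈_ _+_ _*_ -_ 0ₚ 1ₚ
    isCommutativeRing = CommutativeRingAxioms.isCommutativeRing record
      { isEquivalence = record { refl = ≈-refl ; sym = ≈-sym ; trans = ≈-trans }
      ; +-cong        = +-cong
      ; +-assoc       = +-assoc
      ; +-comm        = +-comm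
      ; +-identityˡ   = λ _ → ≈-refl
      ; -‿cong        = neg-cong
      ; -‿inverseˡ    = neg-inverseˡ
      ; *-cong        = *-cong
      ; *-assoc       = *-assoc
      ; *-comm        = *-comm
      ; *-identityˡ   = *-identityˡ
      ; distribʳ      = *-distribʳ
      }

    *-cons : ∀ p b q → p * (b ∷ q) ≈ b · p + (R.0# ∷ p * q)
    *-cons = *-∷

  commutativeRing : CommutativeRing c ℓ
  commutativeRing = record { isCommutativeRing = isCommutativeRing }

  rawLeftModule : RawLeftModule R.Carrier c ℓ
  rawLeftModule = record
    { Carrierᴹ = Poly ; _≈ᴹ_ = _≈_ ; _+ᴹ_ = _+_ ; _*ₗ_ = _·_ ; 0ᴹ = 0ₚ ; -ᴹ_ = -_ }

module PolynomialDomain {c ℓ ν} (D : ApartnessDomain c ℓ ν) where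
  private module D = ApartnessDomain D
  open Polynomial D.commutativeRing
  private module P = CommutativeRing commutativeRing

  NonZero : Poly → Set ν
  NonZero p = ∃ λ n → D.NonZero (coeff p n)

  abstract
    private
      nonZero-resp : ∀ {p q} → p ≈ q → NonZero p → NonZero q
      nonZero-resp (mk≈ e) (n , nz) = n , D.nonZero-resp (e n) nz

      nonZero-+ : ∀ {p q} → NonZero (p + q) → NonZero p ⊎ NonZero q
      nonZero-+ {p} {q} (n , nz) =
        Sum.map (n ,_) (n ,_) (D.nonZero-+ (D.nonZero-resp (coeff-+ p q n) nz))

      nonZero-· : ∀ {a p} → NonZero (a · p) → D.NonZero a
      nonZero-· {a} {p} (n , nz) = D.nonZero-factor (D.nonZero-resp (coeff-· a p n) nz)

      nonZero-neg : ∀ {p} → NonZero (- p) → NonZero p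
      nonZero-neg {p} (n , nz) =
        n , DomainProperties.nonZero-neg⁻¹ D (D.nonZero-resp (coeff-neg p n) nz)

      nonZero-∷ : ∀ {a p} → NonZero (a ∷ p) → D.NonZero a ⊎ NonZero p
      nonZero-∷ (zero  , nz) = inj₁ nz
      nonZero-∷ (suc n , nz) = inj₂ (n , nz)

      nonZero-factor : ∀ p q → NonZero (p * q) → NonZero p
      nonZero-factor []      q (_ , nz) = ⊥-elim (D.¬nonZero-0 nz)
      nonZero-factor (a ∷ p) q nz with nonZero-+ {a · q} nz
      ... | inj₁ aq≠0        = 0 , nonZero-· {a} {q} aq≠0
      ... | inj₂ (zero , nz₀) = ⊥-elim (D.¬nonZero-0 nz₀)
      ... | inj₂ (suc n , nzₙ) = let k , nzₖ = nonZero-factor p q (n , nzₙ) in suc k , nzₖ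

      -- If f · q is nonzero then so is f · (b + X q), unless b itself is.
      extend : ∀ f b q → NonZero (f * q) → NonZero (f * (b ∷ q)) ⊎ D.NonZero b
      extend f b q (n , nz) = Sum.map id (λ nz′ → nonZero-· {b} {f} (nonZero-neg {b · f} nz′))
        (nonZero-+ {p = f * (b ∷ q)} {q = - (b · f)} (nonZero-resp {D.0# ∷ f * q} (P.sym eq) (suc n , nz)))
        where
        open SetoidReasoning P.setoid
        eq : f * (b ∷ q) + - (b · f) ≈ D.0# ∷ f * q
        eq = begin
          f * (b ∷ q) + - (b · f)                 ≈⟨ P.+-congʳ (P.trans (*-cons f b q) (P.+-comm (b · f) _)) ⟩
          (D.0# ∷ f * q) + b · f + - (b · f)      ≈⟨ P.+-assoc _ (b · f) (- (b · f)) ⟩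
          (D.0# ∷ f * q) + (b · f + - (b · f))    ≈⟨ P.+-congˡ {D.0# ∷ f * q} (P.-‿inverseʳ (b · f)) ⟩
          (D.0# ∷ f * q) + []                     ≈⟨ P.+-identityʳ _ ⟩
          (D.0# ∷ f * q)                          ∎

      nonZero-*-step : ∀ a p b q → (NonZero q → NonZero ((a ∷ p) * q)) →
                       (NonZero p → NonZero (p * (b ∷ q))) →
                       NonZero (a ∷ p) → NonZero (b ∷ q) → NonZero ((a ∷ p) * (b ∷ q))
      nonZero-*-step a p b q left right p≠0 q≠0 =
        [ id , (λ b≠0 → [ id , (λ a≠0 → 0 , constant-term a≠0 b≠0) ]′ product≠0⊎a≠0) ]′ product≠0⊎b≠0
        where
        constant-term : D.NonZero a → D.NonZero b → D.NonZero (a D.* b D.+ D.0#)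
        constant-term a≠0 b≠0 = D.nonZero-resp (D.sym (D.+-identityʳ (a D.* b))) (D.nonZero-* a≠0 b≠0)
        product≠0⊎b≠0 : NonZero ((a ∷ p) * (b ∷ q)) ⊎ D.NonZero b
        product≠0⊎b≠0 = [ inj₂ , extend (a ∷ p) b q ∘ left ]′ (nonZero-∷ q≠0)
        product≠0⊎a≠0 : NonZero ((a ∷ p) * (b ∷ q)) ⊎ D.NonZero a
        product≠0⊎a≠0 =
          [ inj₂
          , Sum.map₁ (nonZero-resp (P.*-comm (b ∷ q) (a ∷ p)))
              ∘ extend (b ∷ q) a p ∘ nonZero-resp (P.*-comm p (b ∷ q)) ∘ right
          ]′ (nonZero-∷ p≠0)

      nonZero-* : ∀ p q → NonZero p → NonZero q → NonZero (p * q)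
      nonZero-* []      q       (_ , nz) _        = ⊥-elim (D.¬nonZero-0 nz)
      nonZero-* (a ∷ p) []      _        (_ , nz) = ⊥-elim (D.¬nonZero-0 nz)
      nonZero-* (a ∷ p) (b ∷ q) p≠0      q≠0      = nonZero-*-step a p b q
        (nonZero-* (a ∷ p) q p≠0) (λ p′≠0 → nonZero-* p (b ∷ q) p′≠0 q≠0) p≠0 q≠0

  domain : ApartnessDomain c ℓ ν
  domain = record
    { commutativeRing = commutativeRing
    ; NonZero         = NonZero
    ; nonZero-resp    = nonZero-resp
    ; ¬nonZero-0      = λ (_ , nz) → D.¬nonZero-0 nz
    ; nonZero-1       = 0 , D.nonZero-1
    ; nonZero-+       = λ {p} {q} → nonZero-+ {p} {q}
    ; nonZero-*       = λ {p} {q} → nonZero-* p q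
    ; nonZero-factor  = λ {p} {q} → nonZero-factor p q
    ; ¬nonZero⇒0      = λ ¬nz → mk≈ λ n → D.¬nonZero⇒0 λ nz → ¬nz (n , nz)
    }

module FractionField {c ℓ ν} (D : ApartnessDomain c ℓ ν) where
  private module D = ApartnessDomain D
  open SemiringSolver D.commutativeSemiring
  open DomainProperties D using (cancelˡ)

  record Fraction : Set (c ⊔ ν) where
    constructor _/_[_]
    field
      num   : D.Carrier
      den   : D.Carrier
      den≠0 : D.NonZero den
  open Fraction

  infix  4 _≈_
  infixl 6 _+_
  infixl 7 _*_
  infix  8 -_

  record _≈_ (x y : Fraction) : Set ℓ where
    constructor mk≈
    field cross-multiply : num x D.* den y D.≈ num y D.* den x

  _+_ _*_ : Fraction → Fraction → Fraction
  (a / b [ b≠0 ]) + (c / d [ d≠0 ]) = (a D.* d D.+ c D.* b) / (b D.* d) [ D.nonZero-* b≠0 d≠0 ]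
  (a / b [ b≠0 ]) * (c / d [ d≠0 ]) = (a D.* c) / (b D.* d) [ D.nonZero-* b≠0 d≠0 ]

  -_ : Fraction → Fraction
  - (a / b [ b≠0 ]) = (D.- a) / b [ b≠0 ]

  embed : D.Carrier → Fraction
  embed a = a / D.1# [ D.nonZero-1 ]

  0/1 1/1 : Fraction
  0/1 = embed D.0#
  1/1 = embed D.1#

  abstract
    private
      open RingProperties D.ring using (-‿distribˡ-*)
      open SetoidReasoning D.setoid

      ≈-trans : ∀ {x y z} → x ≈ y → y ≈ z → x ≈ z
      ≈-trans {a / b [ _ ]} {c / d [ d≠0 ]} {e / f [ _ ]} (mk≈ p) (mk≈ q) = mk≈ (cancelˡ d≠0 (begin
        d D.* (a D.* f)  ≈⟨ solve 3 (λ a d f → d :* (a :* f) := (a :* d) :* f) D.refl a d f ⟩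
        (a D.* d) D.* f  ≈⟨ D.*-congʳ p ⟩
        (c D.* b) D.* f  ≈⟨ solve 3 (λ b c f → (c :* b) :* f := (c :* f) :* b) D.refl b c f ⟩
        (c D.* f) D.* b  ≈⟨ D.*-congʳ q ⟩
        (e D.* d) D.* b  ≈⟨ solve 3 (λ b d e → (e :* d) :* b := d :* (e :* b)) D.refl b d e ⟩
        d D.* (e D.* b)  ∎))

      +-cong : ∀ {x x′ y y′} → x ≈ x′ → y ≈ y′ → x + y ≈ x′ + y′
      +-cong {a / b [ _ ]} {a′ / b′ [ _ ]} {c / d [ _ ]} {c′ / d′ [ _ ]} (mk≈ p) (mk≈ q) = mk≈ (begin
        (a D.* d D.+ c D.* b) D.* (b′ D.* d′)
          ≈⟨ solve 6 (λ a b c d b′ d′ → (a :* d :+ c :* b) :* (b′ :* d′) :=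
               (a :* b′) :* (d :* d′) :+ (c :* d′) :* (b :* b′)) D.refl a b c d b′ d′ ⟩
        (a D.* b′) D.* (d D.* d′) D.+ (c D.* d′) D.* (b D.* b′)
          ≈⟨ D.+-cong (D.*-congʳ p) (D.*-congʳ q) ⟩
        (a′ D.* b) D.* (d D.* d′) D.+ (c′ D.* d) D.* (b D.* b′)
          ≈⟨ solve 6 (λ a′ b c′ d b′ d′ → (a′ :* b) :* (d :* d′) :+ (c′ :* d) :* (b :* b′) :=
               (a′ :* d′ :+ c′ :* b′) :* (b :* d)) D.refl a′ b c′ d b′ d′ ⟩
        (a′ D.* d′ D.+ c′ D.* b′) D.* (b D.* d) ∎)

      *-cong : ∀ {x x′ y y′} → x ≈ x′ → y ≈ y′ → x * y ≈ x′ * y′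
      *-cong {a / b [ _ ]} {a′ / b′ [ _ ]} {c / d [ _ ]} {c′ / d′ [ _ ]} (mk≈ p) (mk≈ q) = mk≈ (begin
        (a D.* c) D.* (b′ D.* d′)
          ≈⟨ solve 4 (λ a c b′ d′ → (a :* c) :* (b′ :* d′) := (a :* b′) :* (c :* d′)) D.refl a c b′ d′ ⟩
        (a D.* b′) D.* (c D.* d′)
          ≈⟨ D.*-cong p q ⟩
        (a′ D.* b) D.* (c′ D.* d)
          ≈⟨ solve 4 (λ a′ b c′ d → (a′ :* b) :* (c′ :* d) := (a′ :* c′) :* (b :* d)) D.refl a′ b c′ d ⟩
        (a′ D.* c′) D.* (b D.* d) ∎)

    isCommutativeRing : IsCommutativeRing _≈_ _+_ _*_ -_ 0/1 1/1
    isCommutativeRing = CommutativeRingAxioms.isCommutativeRing record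
      { isEquivalence = record
        { refl  = mk≈ D.refl
        ; sym   = λ (mk≈ p) → mk≈ (D.sym p)
        ; trans = ≈-trans
        }
      ; +-cong = +-cong
      ; +-assoc = λ (a / b [ _ ]) (c / d [ _ ]) (e / f [ _ ]) → mk≈ (solve 6 (λ a b c d e f →
          ((a :* d :+ c :* b) :* f :+ e :* (b :* d)) :* (b :* (d :* f)) :=
          (a :* (d :* f) :+ (c :* f :+ e :* d) :* b) :* ((b :* d) :* f)) D.refl a b c d e f)
      ; +-comm = λ (a / b [ _ ]) (c / d [ _ ]) → mk≈ (solve 4 (λ a b c d →
          (a :* d :+ c :* b) :* (d :* b) := (c :* b :+ a :* d) :* (b :* d)) D.refl a b c d)
      ; +-identityˡ = λ (a / b [ _ ]) → mk≈ (solve 2 (λ a b →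
          (con 0 :* b :+ a :* con 1) :* b := a :* (con 1 :* b)) D.refl a b)
      ; -‿cong = λ { {a / b [ _ ]} {c / d [ _ ]} (mk≈ p) → mk≈ (begin
          (D.- a) D.* d    ≈⟨ -‿distribˡ-* a d ⟨
          D.- (a D.* d)    ≈⟨ D.-‿cong p ⟩
          D.- (c D.* b)    ≈⟨ -‿distribˡ-* c b ⟩
          (D.- c) D.* b    ∎) }
      ; -‿inverseˡ = λ (a / b [ _ ]) → mk≈ (begin
          ((D.- a) D.* b D.+ a D.* b) D.* D.1#  ≈⟨ D.*-identityʳ _ ⟩
          (D.- a) D.* b D.+ a D.* b             ≈⟨ D.distribʳ b (D.- a) a ⟨
          (D.- a D.+ a) D.* b                   ≈⟨ D.*-congʳ (D.-‿inverseˡ a) ⟩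
          D.0# D.* b                            ≈⟨ D.zeroˡ b ⟩
          D.0#                                  ≈⟨ D.zeroˡ (b D.* b) ⟨
          D.0# D.* (b D.* b)                    ∎)
      ; *-cong = *-cong
      ; *-assoc = λ (a / b [ _ ]) (c / d [ _ ]) (e / f [ _ ]) → mk≈ (solve 6 (λ a b c d e f →
          ((a :* c) :* e) :* (b :* (d :* f)) := (a :* (c :* e)) :* ((b :* d) :* f)) D.refl a b c d e f)
      ; *-comm = λ (a / b [ _ ]) (c / d [ _ ]) → mk≈ (solve 4 (λ a b c d →
          (a :* c) :* (d :* b) := (c :* a) :* (b :* d)) D.refl a b c d)
      ; *-identityˡ = λ (a / b [ _ ]) → mk≈ (solve 2 (λ a b →
          (con 1 :* a) :* b := a :* (con 1 :* b)) D.refl a b)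
      ; distribʳ = λ (a / b [ _ ]) (c / d [ _ ]) (e / f [ _ ]) → mk≈ (solve 6 (λ a b c d e f →
          ((c :* f :+ e :* d) :* a) :* ((d :* b) :* (f :* b)) :=
          ((c :* a) :* (f :* b) :+ (e :* a) :* (d :* b)) :* ((d :* f) :* b)) D.refl a b c d e f)
      }

  commutativeRing : CommutativeRing (c ⊔ ν) ℓ
  commutativeRing = record { isCommutativeRing = isCommutativeRing }

  NonZero : Fraction → Set ν
  NonZero x = D.NonZero (num x)

  abstract
    private
      nonZero-resp : ∀ {x y} → x ≈ y → NonZero x → NonZero y
      nonZero-resp {x} {y} (mk≈ p) nz = D.nonZero-factor (D.nonZero-resp p (D.nonZero-* nz (den≠0 y)))

      nonZero⇒0 : ∀ {x} → ¬ NonZero x → x ≈ 0/1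
      nonZero⇒0 {a / b [ _ ]} ¬nz = mk≈ (begin
        a D.* D.1#    ≈⟨ D.*-congʳ (D.¬nonZero⇒0 ¬nz) ⟩
        D.0# D.* D.1# ≈⟨ D.zeroˡ D.1# ⟩
        D.0#          ≈⟨ D.zeroˡ b ⟨
        D.0# D.* b    ∎)

  domain : ApartnessDomain (c ⊔ ν) ℓ ν
  domain = record
    { commutativeRing = commutativeRing
    ; NonZero         = NonZero
    ; nonZero-resp    = nonZero-resp
    ; ¬nonZero-0      = D.¬nonZero-0
    ; nonZero-1       = D.nonZero-1
    ; nonZero-+       = Sum.map D.nonZero-factor D.nonZero-factor ∘ D.nonZero-+
    ; nonZero-*       = D.nonZero-*
    ; nonZero-factor  = D.nonZero-factor
    ; ¬nonZero⇒0      = nonZero⇒0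
    }

  inverse : ∀ x → NonZero x → ∃ λ y → x * y ≈ 1/1
  inverse (a / b [ b≠0 ]) a≠0 = b / a [ a≠0 ] ,
    mk≈ (solve 2 (λ a b → (a :* b) :* con 1 := con 1 :* (b :* a)) D.refl a b)

  heytingField : HeytingField (c ⊔ ν) ℓ ν
  heytingField = DomainProperties.heytingField domain inverse

ℂ[x] : CommutativeRing 0ℓ 0ℓ
ℂ[x] = Polynomial.commutativeRing Complex.commutativeRing

-- The field ℂ(x)
ℂ⟨x⟩ : HeytingField 0ℓ 0ℓ 0ℓ
ℂ⟨x⟩ = FractionField.heytingField (PolynomialDomain.domain Complex.domain)

-- A polynomial viewed as a rational function
embed : CommutativeRing.Carrier ℂ[x] → HeytingField.Carrier ℂ⟨x⟩
embed = FractionField.embed (PolynomialDomain.domain Complex.domain)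

module RingOperations {c ℓ} (R : CommutativeRing c ℓ) where
  open CommutativeRing R using (Carrier; semiring)
  open RawSemiringOperations (Semiring.rawSemiring semiring) public
    using (sum; _^_) renaming (_×_ to infixr 7 _·ℕ_)

  -- The sum of f i over a ≤ i ≤ b
  sumFromTo : ℕ → ℕ → (ℕ → Carrier) → Carrier
  sumFromTo a b f = sum {suc b ℕ.∸ a} (λ j → f (a ℕ.+ toℕ j))

module OrthogonalPolynomials {c ℓ ν} (K : HeytingField c ℓ ν) where
  private
    module K = HeytingField K
    K-ring : CommutativeRing c ℓ
    K-ring = HeytingCommutativeRing.commutativeRing K.heytingCommutativeRing
  open Polynomial K-ring
  open RingOperations commutativeRing using (_^_)
  open LeftModuleMorphisms rawLeftModule
    (LeftModule.rawLeftModule (TensorUnit.leftModule {R = CommutativeRing.ring K-ring}))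
    renaming (IsLeftModuleHomomorphism to IsLinear)

  record IsMonicOfDegree (n : ℕ) (p : Poly) : Set ℓ where
    field
      leading : coeff p n K.≈ K.1#
      above   : ∀ k → n ℕ.< k → coeff p k K.≈ K.0#

  record IsOrthogonalizing (ℒ : Poly → K.Carrier) (P : ℕ → Poly) : Set (c ⊔ ℓ ⊔ ν) where
    field
      linear        : IsLinear ℒ
      normalized    : ℒ 1ₚ K.≈ K.1#
      orthogonal    : ∀ {i j} → i ≢ j → ℒ (P i * P j) K.≈ K.0#
      nondegenerate : ∀ n → ℒ (P n * P n) K.# K.0#

  record IsMomentSequenceOfOrthogonalPolynomials (μ : ℕ → K.Carrier) : Set (c ⊔ ℓ ⊔ ν) where
    field
      P               : ℕ → Poly
      monic           : ∀ n → IsMonicOfDegree n (P n)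
      ℒ               : Poly → K.Carrier
      orthogonalizing : IsOrthogonalizing ℒ P
      moments         : ∀ n → ℒ (X ^ n) K.≈ μ n

-- Stirling numbers of the second kind
S : ℕ → ℕ → ℕ
S zero    zero    = 1
S zero    (suc k) = 0
S (suc n) zero    = 0
S (suc n) (suc k) = suc k ℕ.* S n (suc k) ℕ.+ S n k

module EulerianDowling {c ℓ} (R : CommutativeRing c ℓ) where
  private module R = CommutativeRing R
  open Polynomial R using (Poly; const; X) renaming (commutativeRing to R[x])
  private module R[x] = CommutativeRing R[x]

  whitney : R.Carrier → ℕ → ℕ → R.Carrier
  whitney m n k = sumFromTo k n λ i → ((n C i) ℕ.* S i k) ·ℕ m ^ (i ℕ.∸ k)
    where open RingOperations R

  eulerianDowling : R.Carrier → ℕ → Poly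
  eulerianDowling m n = sumFromTo 0 n λ k →
      (k !) ·ℕ (const (whitney m n k) R[x].* (X R[x].- R[x].1#) ^ (n ℕ.∸ k))
    where open RingOperations R[x]

open EulerianDowling Complex.commutativeRing public using (whitney; eulerianDowling)

-- Put y = x - 1 and a = m y. The orthogonal polynomials are those with recurrence
-- coefficients bₙ = 1 + y + n (2 + a) and λₙ = n² (1 + a). They satisfy
-- ∏_{i<k} (z - y - i a) = Σⱼ (k choose j)² (k - j)! Pⱼ(z), so their functional takes
-- the value k! on this product, while zⁿ = Σₖ W_m(n,k) yⁿ⁻ᵏ ∏_{i<k} (z - y - i a).
-- All λₙ are nonzero because 1 + a has the coefficients 1 - m and m, of sum 1.

module Submission where

open import Defs

open import Algebra.Apartness.Bundles using (HeytingField; HeytingCommutativeRing)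
import Algebra.Apartness.Properties.HeytingCommutativeRing as ApartnessProperties
open import Algebra.Bundles using (CommutativeRing; Semiring)
open import Algebra.Morphism.Structures using (module SemiringMorphisms)
import Algebra.Properties.Ring as RingProperties
import Algebra.Properties.Semiring.Mult as Multiples
import Algebra.Properties.Semiring.Sum as FiniteSums
import Algebra.Solver.Ring.NaturalCoefficients.Default as SemiringSolver
open import Data.Fin.Base using (toℕ)
open import Data.List.Base using ([]; _∷_)
open import Data.Nat.Base as ℕ using (ℕ; zero; suc; _!; _∸_)
open import Data.Nat.Combinatorics using (_C_; k>n⇒nCk≡0; nCk+nC[k+1]≡[n+1]C[k+1])
import Data.Nat.Properties as ℕₚ
open import Data.Nat.Solver using (module +-*-Solver)
open import Data.Product.Base using (_,_)
open import Data.Rational.Base as Rat using (0ℚ; 1ℚ)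
import Data.Rational.Properties as ℚₚ
open import Data.Sum.Base using (inj₁; inj₂; [_,_]′)
open import Relation.Binary.PropositionalEquality as ≡ using (_≡_; _≢_)
import Relation.Binary.Reasoning.Setoid as SetoidReasoning
open import Relation.Nullary.Negation.Core using (contradiction)

-- The exponential generating function of the moments is e^(yt) a / (1 + a - e^(at)). For m nonzero
-- this is, formally, a geometric distribution of ratio 1/(1 + a) on the points y, y + a, y + 2a,
-- ...; its orthogonal polynomials are the Meixner polynomials with parameter 1, rescaled by a and
-- translated by y, which is where bₙ and λₙ come from. The k-th factorial moment of that
-- distribution is k!/a^k, whence the value k!. For m = 0 the family degenerates to translated
-- Laguerre polynomials. Whether m is 0 cannot be decided in ℂ, so both cases must be treated at
-- once and nothing may be divided by a. The moments are therefore computed in ℂ[x], with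
-- coordinates relative to the basis (Pₙ), in which multiplication by z is a tridiagonal operator;
-- the result is then carried over to ℂ(x).

-- Coordinate sequences and tridiagonal operators

module Sequences {c ℓ} (R : CommutativeRing c ℓ) where
  open CommutativeRing R

  Seq : Set c
  Seq = ℕ → Carrier

  infix 4 _≋_
  _≋_ : Seq → Seq → Set ℓ
  u ≋ v = ∀ j → u j ≈ v j

  shift : Seq → Seq
  shift v zero    = 0#
  shift v (suc j) = v j

  -- The unit vectors. With the last clause, `shift (e n) j` is `e (suc n) j` by definition, which
  -- `Z-e₀` and `Z-e₊` rely on.
  e : ℕ → Seq
  e zero    zero    = 1#
  e zero    (suc j) = 0#
  e (suc n) j       = shift (e n) j

  shift-cong : ∀ {u v} → u ≋ v → shift u ≋ shift v
  shift-cong u≋v zero    = refl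
  shift-cong u≋v (suc j) = u≋v j

  shift-linear : ∀ r s u v → shift (λ j → r * u j + s * v j) ≋ (λ j → r * shift u j + s * shift v j)
  shift-linear r s u v zero    = sym (trans (+-cong (zeroʳ r) (zeroʳ s)) (+-identityʳ 0#))
  shift-linear r s u v (suc j) = refl

  e-diagonal : ∀ n → e n n ≈ 1#
  e-diagonal zero    = refl
  e-diagonal (suc n) = e-diagonal n

  e-off-diagonal : ∀ {n j} → n ≢ j → e n j ≈ 0#
  e-off-diagonal {zero}  {zero}  n≢j = contradiction ≡.refl n≢j
  e-off-diagonal {zero}  {suc j} n≢j = refl
  e-off-diagonal {suc n} {zero}  n≢j = refl
  e-off-diagonal {suc n} {suc j} n≢j = e-off-diagonal (λ n≡j → n≢j (≡.cong suc n≡j))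

  -- Since `e n` is supported at n, a diagonal operator acts on it as the scalar `f n`.
  *-e : ∀ f n j → f j * e n j ≈ f n * e n j
  *-e f zero    zero    = refl
  *-e f zero    (suc j) = trans (zeroʳ _) (sym (zeroʳ _))
  *-e f (suc n) zero    = trans (zeroʳ _) (sym (zeroʳ _))
  *-e f (suc n) (suc j) = *-e (λ i → f (suc i)) n j

-- The operator given by the Jacobi matrix with diagonal b, subdiagonal 1 and
-- superdiagonal l; in the usual notation l n is λₙ₊₁.
module JacobiOperator {c ℓ} (R : CommutativeRing c ℓ) (b l : ℕ → CommutativeRing.Carrier R) where
  open CommutativeRing R
  open SemiringSolver commutativeSemiring using (solve; _:+_; _:*_; _:=_)
  open SetoidReasoning setoid
  open Sequences R

  Z : Seq → Seq
  Z v j = shift v j + (b j * v j + l j * v (suc j))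

  Z^ : ℕ → Seq → Seq
  Z^ zero    v = v
  Z^ (suc n) v = Z (Z^ n v)

  Z-cong : ∀ {u v} → u ≋ v → Z u ≋ Z v
  Z-cong u≋v j = +-cong (shift-cong u≋v j) (+-cong (*-congˡ (u≋v j)) (*-congˡ (u≋v (suc j))))

  Z^-cong : ∀ n {u v} → u ≋ v → Z^ n u ≋ Z^ n v
  Z^-cong zero    u≋v = u≋v
  Z^-cong (suc n) u≋v = Z-cong (Z^-cong n u≋v)

  Z-linear : ∀ r s u v → Z (λ j → r * u j + s * v j) ≋ (λ j → r * Z u j + s * Z v j)
  Z-linear r s u v j = trans (+-congʳ (shift-linear r s u v j))
    (solve 10 (λ r s b l u₋ u u₊ v₋ v v₊ →
      (r :* u₋ :+ s :* v₋) :+ (b :* (r :* u :+ s :* v) :+ l :* (r :* u₊ :+ s :* v₊)) :=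
      r :* (u₋ :+ (b :* u :+ l :* u₊)) :+ s :* (v₋ :+ (b :* v :+ l :* v₊)))
      refl r s (b j) (l j) (shift u j) (u j) (u (suc j)) (shift v j) (v j) (v (suc j)))

  Z-+ : ∀ u v → Z (λ j → u j + v j) ≋ (λ j → Z u j + Z v j)
  Z-+ u v j = begin
    Z (λ i → u i + v i) j              ≈⟨ Z-cong (λ i → +-cong (*-identityˡ _) (*-identityˡ _)) j ⟨
    Z (λ i → 1# * u i + 1# * v i) j    ≈⟨ Z-linear 1# 1# u v j ⟩
    1# * Z u j + 1# * Z v j            ≈⟨ +-cong (*-identityˡ _) (*-identityˡ _) ⟩
    Z u j + Z v j                      ∎

  Z-* : ∀ r v → Z (λ j → r * v j) ≋ (λ j → r * Z v j)
  Z-* r v j = begin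
    Z (λ i → r * v i) j              ≈⟨ Z-cong (λ i → trans (+-congˡ (zeroˡ _)) (+-identityʳ _)) j ⟨
    Z (λ i → r * v i + 0# * v i) j   ≈⟨ Z-linear r 0# v v j ⟩
    r * Z v j + 0# * Z v j           ≈⟨ trans (+-congˡ (zeroˡ _)) (+-identityʳ _) ⟩
    r * Z v j                        ∎

  Z-0 : Z (λ _ → 0#) ≋ (λ _ → 0#)
  Z-0 j = begin
    Z (λ _ → 0#) j       ≈⟨ Z-cong (λ _ → zeroˡ 0#) j ⟨
    Z (λ _ → 0# * 0#) j  ≈⟨ Z-* 0# (λ _ → 0#) j ⟩
    0# * Z (λ _ → 0#) j  ≈⟨ zeroˡ _ ⟩
    0#                   ∎

  Z-e₀ : Z (e 0) ≋ (λ j → e 1 j + b 0 * e 0 j)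
  Z-e₀ j = +-congˡ (begin
    b j * e 0 j + l j * 0#  ≈⟨ trans (+-congˡ (zeroʳ _)) (+-identityʳ _) ⟩
    b j * e 0 j             ≈⟨ *-e b 0 j ⟩
    b 0 * e 0 j             ∎)

  -- The three-term recurrence, solved for z Pₙ₊₁, in coordinates. The index of `l` is n because
  -- `e (suc n) (suc j)` reduces to `e n j`.
  Z-e₊ : ∀ n → Z (e (suc n)) ≋ (λ j → e (suc (suc n)) j + (b (suc n) * e (suc n) j + l n * e n j))
  Z-e₊ n j = +-congˡ (+-cong (*-e b (suc n) j) (*-e l n j))

-- Favard's theorem

-- A functional making the polynomials of a three-term recurrence orthogonal is
-- p ↦ (p(J) e₀)₀, where J is the Jacobi matrix of the recurrence: one has
-- Pₙ(J) e₀ = eₙ, and v ↦ (Pₙ(J) v)₀ is λ₁ ⋯ λₙ times the n-th coordinate.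
module Favard {c ℓ ν} (K : HeytingField c ℓ ν) (b l : ℕ → HeytingField.Carrier K)
              (l#0 : ∀ n → HeytingField._#_ K (l n) (HeytingField.0# K)) where
  private
    module HF = HeytingField K
    K-ring : CommutativeRing c ℓ
    K-ring = HeytingCommutativeRing.commutativeRing HF.heytingCommutativeRing
  open CommutativeRing K-ring
  open RingProperties ring using (-‿distribˡ-*; -‿+-comm)
  open ApartnessProperties HF.heytingCommutativeRing using (#-congʳ; x#0y#0→xy#0; 1#0)
  open SemiringSolver commutativeSemiring using (solve; _:+_; _:*_; _:=_)
  open SetoidReasoning setoid
  open Sequences K-ring
  open JacobiOperator K-ring b l
  open Polynomial K-ring using (Poly; coeff; 1ₚ; X; mk≈; coeff-+; coeff-·)
  private
    module Poly = Polynomial K-ring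
    module K[z] = CommutativeRing Poly.commutativeRing
  open OrthogonalPolynomials K
  open RingOperations Poly.commutativeRing using (_^_)

  -- Horner's scheme for p(J) v. Every row of J is finite, so p(J) acts on arbitrary sequences, as
  -- `act-P-head` requires.
  act : Poly → Seq → Seq
  act []      v j = 0#
  act (a ∷ p) v j = a * v j + Z (act p v) j

  act-congʳ : ∀ p {u v} → u ≋ v → act p u ≋ act p v
  act-congʳ []      u≋v j = refl
  act-congʳ (a ∷ p) u≋v j = +-cong (*-congˡ (u≋v j)) (Z-cong (act-congʳ p u≋v) j)

  -- Equal polynomials may differ by trailing zeros as lists; this handles the excess entries in
  -- `act-congˡ`.
  act-≈0 : ∀ p v → p Poly.≈ [] → act p v ≋ (λ _ → 0#)
  act-≈0 []      v p≈0       j = refl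
  act-≈0 (a ∷ p) v (mk≈ eq) j = begin
    a * v j + Z (act p v) j    ≈⟨ +-cong (*-congʳ (eq 0)) (Z-cong (act-≈0 p v (mk≈ λ n → eq (suc n))) j) ⟩
    0# * v j + Z (λ _ → 0#) j  ≈⟨ +-cong (zeroˡ (v j)) (Z-0 j) ⟩
    0# + 0#                    ≈⟨ +-identityʳ 0# ⟩
    0#                         ∎

  act-congˡ : ∀ {p q} → p Poly.≈ q → ∀ v → act p v ≋ act q v
  act-congˡ {[]}    {q}     p≈q       v j = sym (act-≈0 q v (K[z].sym p≈q) j)
  act-congˡ {a ∷ p} {[]}    p≈q       v j = act-≈0 (a ∷ p) v p≈q j
  act-congˡ {a ∷ p} {b ∷ q} (mk≈ eq) v j =
    +-cong (*-congʳ (eq 0)) (Z-cong (act-congˡ {p} {q} (mk≈ λ n → eq (suc n)) v) j)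

  act-+ : ∀ p q v → act (p Poly.+ q) v ≋ (λ j → act p v j + act q v j)
  act-+ []      q       v j = sym (+-identityˡ _)
  act-+ (a ∷ p) []      v j = sym (+-identityʳ _)
  act-+ (a ∷ p) (b ∷ q) v j = begin
    (a + b) * v j + Z (act (p Poly.+ q) v) j
      ≈⟨ +-congˡ (trans (Z-cong (act-+ p q v) j) (Z-+ (act p v) (act q v) j)) ⟩
    (a + b) * v j + (Z (act p v) j + Z (act q v) j)
      ≈⟨ solve 5 (λ a b x y z → (a :+ b) :* x :+ (y :+ z) := (a :* x :+ y) :+ (b :* x :+ z)) refl
           a b (v j) (Z (act p v) j) (Z (act q v) j) ⟩
    (a * v j + Z (act p v) j) + (b * v j + Z (act q v) j) ∎

  act-· : ∀ r p v → act (r Poly.· p) v ≋ (λ j → r * act p v j)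
  act-· r []      v j = sym (zeroʳ r)
  act-· r (a ∷ p) v j = begin
    r * a * v j + Z (act (r Poly.· p) v) j  ≈⟨ +-cong (*-assoc r a (v j)) (Z-cong (act-· r p v) j) ⟩
    r * (a * v j) + Z (λ i → r * act p v i) j  ≈⟨ +-congˡ (Z-* r (act p v) j) ⟩
    r * (a * v j) + r * Z (act p v) j       ≈⟨ distribˡ r _ _ ⟨
    r * (a * v j + Z (act p v) j)           ∎

  act-0∷ : ∀ p v → act (0# ∷ p) v ≋ Z (act p v)
  act-0∷ p v j = trans (+-congʳ (zeroˡ (v j))) (+-identityˡ _)

  act-* : ∀ p q v → act (p Poly.* q) v ≋ act p (act q v)
  act-* []      q v j = refl
  act-* (a ∷ p) q v j = begin
    act (a Poly.· q Poly.+ (0# ∷ p Poly.* q)) v j          ≈⟨ act-+ (a Poly.· q) (0# ∷ p Poly.* q) v j ⟩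
    act (a Poly.· q) v j + act (0# ∷ p Poly.* q) v j       ≈⟨ +-cong (act-· a q v j) (act-0∷ (p Poly.* q) v j) ⟩
    a * act q v j + Z (act (p Poly.* q) v) j               ≈⟨ +-congˡ (Z-cong (act-* p q v) j) ⟩
    a * act q v j + Z (act p (act q v)) j                  ∎

  act-1 : ∀ v → act 1ₚ v ≋ v
  act-1 v j = begin
    1# * v j + Z (λ _ → 0#) j  ≈⟨ +-cong (*-identityˡ _) (Z-0 j) ⟩
    v j + 0#                   ≈⟨ +-identityʳ _ ⟩
    v j                        ∎

  act-Z : ∀ p v → act p (Z v) ≋ Z (act p v)
  act-Z []      v j = sym (Z-0 j)
  act-Z (a ∷ p) v j = begin
    a * Z v j + Z (act p (Z v)) j               ≈⟨ +-cong (sym (Z-* a v j)) (Z-cong (act-Z p v) j) ⟩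
    Z (λ i → a * v i) j + Z (Z (act p v)) j     ≈⟨ Z-+ (λ i → a * v i) (Z (act p v)) j ⟨
    Z (λ i → a * v i + Z (act p v) i) j         ∎

  act-X^ : ∀ n v → act (X ^ n) v ≋ Z^ n v
  act-X^ zero    v = act-1 v
  act-X^ (suc n) v j = begin
    act (X Poly.* X ^ n) v j         ≈⟨ act-* X (X ^ n) v j ⟩
    act X (act (X ^ n) v) j          ≈⟨ act-0∷ 1ₚ (act (X ^ n) v) j ⟩
    Z (act 1ₚ (act (X ^ n) v)) j     ≈⟨ Z-cong (act-1 (act (X ^ n) v)) j ⟩
    Z (act (X ^ n) v) j              ≈⟨ Z-cong (act-X^ n v) j ⟩
    Z (Z^ n v) j                     ∎

  mutual
    P : ℕ → Poly
    P zero    = 1ₚ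
    P (suc n) = (0# ∷ P n) Poly.+ ((- b n) Poly.· P n Poly.+ lower n)

    -- lower n = - λₙ Pₙ₋₁
    lower : ℕ → Poly
    lower zero    = []
    lower (suc n) = (- l n) Poly.· P n

  act-P-suc : ∀ n v → act (P (suc n)) v ≋ λ j → Z (act (P n) v) j + (- b n * act (P n) v j + act (lower n) v j)
  act-P-suc n v j = begin
    act (P (suc n)) v j
      ≈⟨ act-+ (0# ∷ P n) ((- b n) Poly.· P n Poly.+ lower n) v j ⟩
    act (0# ∷ P n) v j + act ((- b n) Poly.· P n Poly.+ lower n) v j
      ≈⟨ +-cong (act-0∷ (P n) v j) (trans (act-+ ((- b n) Poly.· P n) (lower n) v j) (+-congʳ (act-· (- b n) (P n) v j))) ⟩
    Z (act (P n) v) j + (- b n * act (P n) v j + act (lower n) v j) ∎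

  -- The terms that the recurrence for `P` subtracts are the ones that `Z` produces; both inductions
  -- below end with this cancellation.
  cancel-pair : ∀ x y z u w → (x + (y * z + u * w)) + (- y * z + - u * w) ≈ x
  cancel-pair x y z u w = begin
    (x + (y * z + u * w)) + (- y * z + - u * w)
      ≈⟨ +-congˡ (+-cong (-‿distribˡ-* y z) (-‿distribˡ-* u w)) ⟨
    (x + (y * z + u * w)) + (- (y * z) + - (u * w))
      ≈⟨ +-congˡ (-‿+-comm (y * z) (u * w)) ⟩
    (x + (y * z + u * w)) + - (y * z + u * w)
      ≈⟨ +-assoc x _ _ ⟩
    x + ((y * z + u * w) + - (y * z + u * w))
      ≈⟨ +-congˡ (-‿inverseʳ _) ⟩
    x + 0#
      ≈⟨ +-identityʳ x ⟩
    x ∎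

  cancel-one : ∀ x y z → (x + y * z) + (- y * z + 0#) ≈ x
  cancel-one x y z = begin
    (x + y * z) + (- y * z + 0#)               ≈⟨ +-cong (+-congˡ (+-identityʳ _)) (+-congˡ (zeroʳ (- 0#))) ⟨
    (x + (y * z + 0#)) + (- y * z + - 0# * 0#) ≈⟨ +-congʳ (+-congˡ (+-congˡ (zeroʳ 0#))) ⟨
    (x + (y * z + 0# * 0#)) + (- y * z + - 0# * 0#) ≈⟨ cancel-pair x y z 0# 0# ⟩
    x                                          ∎

  act-P-e₀ : ∀ n → act (P n) (e 0) ≋ e n
  act-P-e₀ zero          = act-1 (e 0)
  act-P-e₀ (suc zero)  j = begin
    act (P 1) (e 0) j
      ≈⟨ act-P-suc 0 (e 0) j ⟩
    Z (act 1ₚ (e 0)) j + (- b 0 * act 1ₚ (e 0) j + 0#)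
      ≈⟨ +-cong (Z-cong (act-1 (e 0)) j) (+-congʳ (*-congˡ (act-1 (e 0) j))) ⟩
    Z (e 0) j + (- b 0 * e 0 j + 0#)
      ≈⟨ +-congʳ (Z-e₀ j) ⟩
    (e 1 j + b 0 * e 0 j) + (- b 0 * e 0 j + 0#)
      ≈⟨ cancel-one (e 1 j) (b 0) (e 0 j) ⟩
    e 1 j ∎
  act-P-e₀ (suc (suc n)) j = begin
    act (P (suc (suc n))) (e 0) j
      ≈⟨ act-P-suc (suc n) (e 0) j ⟩
    Z (act (P (suc n)) (e 0)) j + (- b (suc n) * act (P (suc n)) (e 0) j + act ((- l n) Poly.· P n) (e 0) j)
      ≈⟨ +-cong (Z-cong (act-P-e₀ (suc n)) j) (+-cong (*-congˡ (act-P-e₀ (suc n) j))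
           (trans (act-· (- l n) (P n) (e 0) j) (*-congˡ (act-P-e₀ n j)))) ⟩
    Z (e (suc n)) j + (- b (suc n) * e (suc n) j + - l n * e n j)
      ≈⟨ +-congʳ (Z-e₊ n j) ⟩
    (e (suc (suc n)) j + (b (suc n) * e (suc n) j + l n * e n j)) + (- b (suc n) * e (suc n) j + - l n * e n j)
      ≈⟨ cancel-pair _ _ _ _ _ ⟩
    e (suc (suc n)) j ∎

  -- The product λ₁ ⋯ λₙ, which is the value of `ℒ` on the square of `P n`.
  norm : ℕ → Carrier
  norm zero    = 1#
  norm (suc n) = norm n * l n

  mutual
    -- The row counterpart of `act-P-e₀`: the top row of Pₙ(J) is a multiple of the n-th unit row.
    -- The induction runs over all v because the hypothesis is applied to `Z v`.
    act-P-head : ∀ n v → act (P n) v 0 ≈ norm n * v n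
    act-P-head zero    v = trans (act-1 v 0) (sym (*-identityˡ _))
    act-P-head (suc n) v = begin
      act (P (suc n)) v 0
        ≈⟨ act-P-suc n v 0 ⟩
      Z (act (P n) v) 0 + (- b n * act (P n) v 0 + act (lower n) v 0)
        -- Pₙ(J) commutes with J. The n-th coordinate of `Z v` then supplies the new term
        -- `l n * v (suc n)`, and the rest cancels.
        ≈⟨ +-cong (sym (act-Z (P n) v 0)) (+-congˡ (act-lower-head n v)) ⟩
      act (P n) (Z v) 0 + (- b n * act (P n) v 0 + - norm n * shift v n)
        ≈⟨ +-cong (act-P-head n (Z v)) (+-congʳ (*-congˡ (act-P-head n v))) ⟩
      norm n * (shift v n + (b n * v n + l n * v (suc n))) + (- b n * (norm n * v n) + - norm n * shift v n)
        ≈⟨ +-congʳ (solve 6 (λ h s b v l v₊ → h :* (s :+ (b :* v :+ l :* v₊)) :=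
             (h :* l) :* v₊ :+ (b :* (h :* v) :+ h :* s)) refl (norm n) (shift v n) (b n) (v n) (l n) (v (suc n))) ⟩
      (norm n * l n * v (suc n) + (b n * (norm n * v n) + norm n * shift v n)) +
        (- b n * (norm n * v n) + - norm n * shift v n)
        ≈⟨ cancel-pair _ _ _ _ _ ⟩
      norm n * l n * v (suc n) ∎

    -- `shift` covers both cases: it gives 0 for n = 0, where there is no preceding polynomial, and
    -- otherwise the factor λₙ turns `norm` at n - 1 into `norm n`.
    act-lower-head : ∀ n v → act (lower n) v 0 ≈ - norm n * shift v n
    act-lower-head zero    v = sym (zeroʳ _)
    act-lower-head (suc n) v = begin
      act ((- l n) Poly.· P n) v 0  ≈⟨ act-· (- l n) (P n) v 0 ⟩
      - l n * act (P n) v 0         ≈⟨ *-congˡ (act-P-head n v) ⟩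
      - l n * (norm n * v n)        ≈⟨ *-assoc _ _ _ ⟨
      - l n * norm n * v n          ≈⟨ *-congʳ (-‿distribˡ-* (l n) (norm n)) ⟨
      - (l n * norm n) * v n        ≈⟨ *-congʳ (-‿cong (*-comm (l n) (norm n))) ⟩
      - (norm n * l n) * v n        ∎

  mutual
    coeff-P-above : ∀ n k → n ℕ.< k → coeff (P n) k ≈ 0#
    coeff-P-above zero    (suc k) n<k         = refl
    coeff-P-above (suc n) (suc k) (ℕ.s≤s n<k) = begin
      coeff (P (suc n)) (suc k)  ≈⟨ coeff-P-suc n k (ℕₚ.<⇒≤ n<k) ⟩
      coeff (P n) k              ≈⟨ coeff-P-above n k n<k ⟩
      0#                         ∎

    coeff-lower : ∀ n k → n ℕ.≤ k → coeff (lower n) (suc k) ≈ 0#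
    coeff-lower zero    k n≤k = refl
    coeff-lower (suc n) k n≤k = begin
      coeff ((- l n) Poly.· P n) (suc k)  ≈⟨ coeff-· (- l n) (P n) (suc k) ⟩
      - l n * coeff (P n) (suc k)         ≈⟨ *-congˡ (coeff-P-above n (suc k) (ℕₚ.m≤n⇒m≤1+n n≤k)) ⟩
      - l n * 0#                          ≈⟨ zeroʳ _ ⟩
      0#                                  ∎

    -- The subtracted terms have degree at most n, so only z Pₙ contributes beyond degree n. The
    -- case k = n gives monicity, the cases k > n the degree bound.
    coeff-P-suc : ∀ n k → n ℕ.≤ k → coeff (P (suc n)) (suc k) ≈ coeff (P n) k
    coeff-P-suc n k n≤k = begin
      coeff (P (suc n)) (suc k)
        ≈⟨ coeff-+ (0# ∷ P n) ((- b n) Poly.· P n Poly.+ lower n) (suc k) ⟩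
      coeff (P n) k + coeff ((- b n) Poly.· P n Poly.+ lower n) (suc k)
        ≈⟨ +-congˡ (coeff-+ ((- b n) Poly.· P n) (lower n) (suc k)) ⟩
      coeff (P n) k + (coeff ((- b n) Poly.· P n) (suc k) + coeff (lower n) (suc k))
        ≈⟨ +-congˡ (+-cong (trans (coeff-· (- b n) (P n) (suc k)) (*-congˡ (coeff-P-above n (suc k) (ℕ.s≤s n≤k))))
             (coeff-lower n k n≤k)) ⟩
      coeff (P n) k + (- b n * 0# + 0#)
        ≈⟨ +-congˡ (trans (+-identityʳ _) (zeroʳ _)) ⟩
      coeff (P n) k + 0#
        ≈⟨ +-identityʳ _ ⟩
      coeff (P n) k ∎

  P-monic : ∀ n → IsMonicOfDegree n (P n)
  P-monic n = record { leading = leading n ; above = coeff-P-above n }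
    where
    leading : ∀ n → coeff (P n) n ≈ 1#
    leading zero    = refl
    leading (suc n) = trans (coeff-P-suc n n ℕₚ.≤-refl) (leading n)

  ℒ : Poly → Carrier
  ℒ p = act p (e 0) 0

  ℒ-PP : ∀ i j → ℒ (P i Poly.* P j) ≈ norm i * e j i
  ℒ-PP i j = begin
    act (P i Poly.* P j) (e 0) 0     ≈⟨ act-* (P i) (P j) (e 0) 0 ⟩
    act (P i) (act (P j) (e 0)) 0    ≈⟨ act-congʳ (P i) (act-P-e₀ j) 0 ⟩
    act (P i) (e j) 0                ≈⟨ act-P-head i (e j) ⟩
    norm i * e j i                   ∎

  norm#0 : ∀ n → norm n HF.# 0#
  norm#0 zero    = 1#0
  norm#0 (suc n) = x#0y#0→xy#0 (norm#0 n) (l#0 n)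

  ℒ-neg : ∀ p → ℒ (Poly.- p) ≈ - ℒ p
  ℒ-neg p = begin
    ℒ (Poly.- p)                        ≈⟨ +-identityʳ _ ⟨
    ℒ (Poly.- p) + 0#                   ≈⟨ +-congˡ (-‿inverseʳ (ℒ p)) ⟨
    ℒ (Poly.- p) + (ℒ p + - ℒ p)        ≈⟨ +-assoc _ _ _ ⟨
    (ℒ (Poly.- p) + ℒ p) + - ℒ p        ≈⟨ +-congʳ (act-+ (Poly.- p) p (e 0) 0) ⟨
    ℒ (Poly.- p Poly.+ p) + - ℒ p       ≈⟨ +-congʳ (act-≈0 _ (e 0) (K[z].-‿inverseˡ p) 0) ⟩
    0# + - ℒ p                          ≈⟨ +-identityˡ _ ⟩
    - ℒ p                               ∎

  ℒ-orthogonalizing : IsOrthogonalizing ℒ P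
  ℒ-orthogonalizing = record
    { linear = record
      { +ᴹ-isGroupHomomorphism = record
        { isMonoidHomomorphism = record
          { isMagmaHomomorphism = record
            { isRelHomomorphism = record { cong = λ {p} {q} p≈q → act-congˡ {p} {q} p≈q (e 0) 0 }
            ; homo              = λ p q → act-+ p q (e 0) 0
            }
          ; ε-homo = refl
          }
        ; ⁻¹-homo = ℒ-neg
        }
      ; *ₗ-homo = λ r p → act-· r p (e 0) 0
      }
    ; normalized    = act-1 (e 0) 0
    ; orthogonal    = λ {i} {j} i≢j →
        trans (ℒ-PP i j) (trans (*-congˡ (e-off-diagonal (λ j≡i → i≢j (≡.sym j≡i)))) (zeroʳ _))
    ; nondegenerate = λ n → #-congʳ
        (sym (trans (ℒ-PP n n) (trans (*-congˡ (e-diagonal n)) (*-identityʳ _)))) (norm#0 n)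
    }

  favard : ∀ {μ} → (∀ n → Z^ n (e 0) 0 ≈ μ n) → IsMomentSequenceOfOrthogonalPolynomials μ
  favard moments = record
    { P               = P
    ; monic           = P-monic
    ; ℒ               = ℒ
    ; orthogonalizing = ℒ-orthogonalizing
    ; moments         = λ n → trans (act-X^ n (e 0) 0) (moments n)
    }

-- Jacobi operators under ring homomorphisms

module Transport {c₁ ℓ₁ c₂ ℓ₂} (R₁ : CommutativeRing c₁ ℓ₁) (R₂ : CommutativeRing c₂ ℓ₂) where
  private
    module R₁ = CommutativeRing R₁
    module R₂ = CommutativeRing R₂
    module S₁ = Sequences R₁
    module S₂ = Sequences R₂
  open SemiringMorphisms (Semiring.rawSemiring R₁.semiring) (Semiring.rawSemiring R₂.semiring)

  module _ {⟦_⟧ : R₁.Carrier → R₂.Carrier} (hom : IsSemiringHomomorphism ⟦_⟧) (b l : ℕ → R₁.Carrier) where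
    open IsSemiringHomomorphism hom
    private
      module J₁ = JacobiOperator R₁ b l
      module J₂ = JacobiOperator R₂ (λ n → ⟦ b n ⟧) (λ n → ⟦ l n ⟧)

    shift-homo : ∀ v j → ⟦ S₁.shift v j ⟧ R₂.≈ S₂.shift (λ i → ⟦ v i ⟧) j
    shift-homo v zero    = 0#-homo
    shift-homo v (suc j) = R₂.refl

    e-homo : ∀ n j → ⟦ S₁.e n j ⟧ R₂.≈ S₂.e n j
    e-homo zero    zero    = 1#-homo
    e-homo zero    (suc j) = 0#-homo
    e-homo (suc n) zero    = 0#-homo
    e-homo (suc n) (suc j) = e-homo n j

    Z-homo : ∀ v j → ⟦ J₁.Z v j ⟧ R₂.≈ J₂.Z (λ i → ⟦ v i ⟧) j
    Z-homo v j = R₂.trans (+-homo _ _) (R₂.+-cong (shift-homo v j)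
      (R₂.trans (+-homo _ _) (R₂.+-cong (*-homo _ _) (*-homo _ _))))

    Z^-homo : ∀ n v j → ⟦ J₁.Z^ n v j ⟧ R₂.≈ J₂.Z^ n (λ i → ⟦ v i ⟧) j
    Z^-homo zero    v j = R₂.refl
    Z^-homo (suc n) v j = R₂.trans (Z-homo (J₁.Z^ n v) j) (J₂.Z-cong (Z^-homo n v) j)

    Z^-e₀-homo : ∀ n j → ⟦ J₁.Z^ n (S₁.e 0) j ⟧ R₂.≈ J₂.Z^ n (S₂.e 0) j
    Z^-e₀-homo n j = R₂.trans (Z^-homo n (S₁.e 0) j) (J₂.Z^-cong n (e-homo 0) j)

-- Natural multiples and finite sums in a ring

module Casts {c ℓ} (R : CommutativeRing c ℓ) where
  open CommutativeRing R
  open Multiples semiring using (×-congʳ; ×-congˡ; ×-homo-+; ×1-homo-*; ×-assoc-*)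
  open RingOperations R using (_·ℕ_)

  κ : ℕ → Carrier
  κ n = n ·ℕ 1#

  κ-+ : ∀ m n → κ (m ℕ.+ n) ≈ κ m + κ n
  κ-+ = ×-homo-+ 1#

  κ-* : ∀ m n → κ (m ℕ.* n) ≈ κ m * κ n
  κ-* = ×1-homo-*

  κ-cong : ∀ {m n} → m ≡ n → κ m ≈ κ n
  κ-cong = ×-congˡ

  ·ℕ≈κ* : ∀ n x → n ·ℕ x ≈ κ n * x
  ·ℕ≈κ* n x = trans (×-congʳ n (sym (*-identityˡ x))) (sym (×-assoc-* n 1# x))

module _ {c₁ ℓ₁ c₂ ℓ₂} (R₁ : CommutativeRing c₁ ℓ₁) (R₂ : CommutativeRing c₂ ℓ₂) where
  private
    module R₁ = CommutativeRing R₁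
    module R₂ = CommutativeRing R₂
  open SemiringMorphisms (Semiring.rawSemiring R₁.semiring) (Semiring.rawSemiring R₂.semiring)

  κ-homo : ∀ {⟦_⟧} → IsSemiringHomomorphism ⟦_⟧ → ∀ n → ⟦ Casts.κ R₁ n ⟧ R₂.≈ Casts.κ R₂ n
  κ-homo hom zero    = IsSemiringHomomorphism.0#-homo hom
  κ-homo hom (suc n) = R₂.trans (+-homo _ _) (R₂.+-cong 1#-homo (κ-homo hom n))
    where open IsSemiringHomomorphism hom

module Sums {c ℓ} (R : CommutativeRing c ℓ) where
  open CommutativeRing R
  open SetoidReasoning setoid
  open Sequences R
  open RingOperations R using (sum)
  open FiniteSums semiring using (sum-cong-≋; ∑-distrib-+; *-distribˡ-sum)

  -- Abstract, so that the summand can be inferred from a sum.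
  abstract
    ∑ : ℕ → Seq → Carrier
    ∑ n f = sum {n} (λ i → f (toℕ i))

    ∑≈sum : ∀ n f → ∑ n f ≈ sum {n} (λ i → f (toℕ i))
    ∑≈sum n f = refl

    ∑-zero : ∀ f → ∑ 0 f ≈ 0#
    ∑-zero f = refl

    ∑-suc : ∀ n f → ∑ (suc n) f ≈ f 0 + ∑ n (λ i → f (suc i))
    ∑-suc n f = refl

    ∑-cong : ∀ n {f g} → f ≋ g → ∑ n f ≈ ∑ n g
    ∑-cong n f≋g = sum-cong-≋ {n} (λ i → f≋g (toℕ i))

    ∑-+ : ∀ n f g → ∑ n (λ i → f i + g i) ≈ ∑ n f + ∑ n g
    ∑-+ n f g = ∑-distrib-+ {n} (λ i → f (toℕ i)) (λ i → g (toℕ i))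

    ∑-* : ∀ n r f → ∑ n (λ i → r * f i) ≈ r * ∑ n f
    ∑-* n r f = sym (*-distribˡ-sum {n} r (λ i → f (toℕ i)))

    ∑-0 : ∀ n → ∑ n (λ _ → 0#) ≈ 0#
    ∑-0 n = trans (∑-cong n (λ _ → sym (zeroˡ 0#))) (trans (∑-* n 0# (λ _ → 0#)) (zeroˡ _))

    ∑-last : ∀ n f → ∑ (suc n) f ≈ ∑ n f + f n
    ∑-last zero    f = +-comm (f 0) 0#
    ∑-last (suc n) f = trans (+-congˡ (∑-last n (λ i → f (suc i)))) (sym (+-assoc _ _ _))

    ∑-vanishing-last : ∀ n f → f n ≈ 0# → ∑ (suc n) f ≈ ∑ n f
    ∑-vanishing-last n f fn≈0 = trans (∑-last n f) (trans (+-congˡ fn≈0) (+-identityʳ _))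

    -- Passes between sums starting at 0, to which Pascal's rule applies, and sums starting at k, as
    -- in the definition of `whitney`. For k > n all n terms vanish and the truncated difference
    -- gives the empty sum.
    ∑-vanishing-initial : ∀ k n f → (∀ i → i ℕ.< k → f i ≈ 0#) → ∑ n f ≈ ∑ (n ∸ k) (λ i → f (k ℕ.+ i))
    ∑-vanishing-initial zero    n       f f≈0 = refl
    ∑-vanishing-initial (suc k) zero    f f≈0 = refl
    ∑-vanishing-initial (suc k) (suc n) f f≈0 = begin
      f 0 + ∑ n (λ i → f (suc i))      ≈⟨ +-congʳ (f≈0 0 (ℕ.s≤s ℕ.z≤n)) ⟩
      0# + ∑ n (λ i → f (suc i))       ≈⟨ +-identityˡ _ ⟩
      ∑ n (λ i → f (suc i))            ≈⟨ ∑-vanishing-initial k n (λ i → f (suc i)) (λ i i<k → f≈0 (suc i) (ℕ.s≤s i<k)) ⟩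
      ∑ (n ∸ k) (λ i → f (suc (k ℕ.+ i))) ∎

    shift-∑ : ∀ n (r : Seq) (f : ℕ → Seq) k →
              shift (λ j → ∑ n (λ i → r i * f i j)) k ≈ ∑ n (λ i → r i * shift (f i) k)
    shift-∑ n r f zero    = sym (trans (∑-cong n (λ i → zeroʳ (r i))) (∑-0 n))
    shift-∑ n r f (suc k) = refl

-- The recurrence of the Whitney numbers

S-vanishing : ∀ i k → i ℕ.< k → S i k ≡ 0
S-vanishing zero    (suc k) i<k         = ≡.refl
S-vanishing (suc i) (suc k) (ℕ.s≤s i<k)
  rewrite S-vanishing i (suc k) (ℕₚ.m<n⇒m<1+n i<k) | S-vanishing i k i<k = ≡.trans (ℕₚ.+-identityʳ _) (ℕₚ.*-zeroʳ k)

module Whitney {c ℓ} (R : CommutativeRing c ℓ) (m : CommutativeRing.Carrier R) where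
  open CommutativeRing R
  open SemiringSolver commutativeSemiring using (solve; _:+_; _:*_; _:=_)
  open Multiples semiring using (×-assocˡ)
  open SetoidReasoning setoid
  open Sequences R
  open Sums R
  open Casts R
  open RingOperations R using (_·ℕ_; _^_)

  W : ℕ → ℕ → Carrier
  W = EulerianDowling.whitney R m

  -- The coefficients of z^i in the products z (z - m) ⋯ (z - (k - 1) m). The Whitney numbers are
  -- their binomial transform in i.
  T : ℕ → ℕ → Carrier
  T i k = S i k ·ℕ m ^ (i ∸ k)

  T-vanishing : ∀ i k → i ℕ.< k → T i k ≈ 0#
  T-vanishing i k i<k rewrite S-vanishing i k i<k = refl

  -- For k < i the two exponents differ by one. For i ≤ k truncation makes both 0, and the identity
  -- is saved by `S i (suc k)` being 0.
  T-*-m : ∀ i k → S i (suc k) ·ℕ m ^ (i ∸ k) ≈ m * T i (suc k)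
  T-*-m i k with ℕₚ.<-≤-connex k i
  ... | inj₁ k<i rewrite ℕₚ.+-∸-assoc 1 k<i = begin
    S i (suc k) ·ℕ (m * m ^ (i ∸ suc k))    ≈⟨ ·ℕ≈κ* (S i (suc k)) _ ⟩
    κ (S i (suc k)) * (m * m ^ (i ∸ suc k)) ≈⟨ solve 3 (λ s m p → s :* (m :* p) := m :* (s :* p)) refl _ _ _ ⟩
    m * (κ (S i (suc k)) * m ^ (i ∸ suc k)) ≈⟨ *-congˡ (·ℕ≈κ* (S i (suc k)) _) ⟨
    m * T i (suc k)                         ∎
  ... | inj₂ i≤k rewrite S-vanishing i (suc k) (ℕ.s≤s i≤k) = sym (zeroʳ m)

  T-suc : ∀ i k → T (suc i) k ≈ shift (T i) k + κ k * m * T i k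
  T-suc i zero    = sym (trans (+-identityˡ _) (trans (*-congʳ (zeroˡ m)) (zeroˡ _)))
  T-suc i (suc k) = begin
    (suc k ℕ.* S i (suc k) ℕ.+ S i k) ·ℕ m ^ (i ∸ k)
      ≈⟨ ·ℕ≈κ* (suc k ℕ.* S i (suc k) ℕ.+ S i k) _ ⟩
    κ (suc k ℕ.* S i (suc k) ℕ.+ S i k) * m ^ (i ∸ k)
      ≈⟨ *-congʳ (trans (κ-+ (suc k ℕ.* S i (suc k)) (S i k)) (+-congʳ (κ-* (suc k) (S i (suc k))))) ⟩
    (κ (suc k) * κ (S i (suc k)) + κ (S i k)) * m ^ (i ∸ k)
      ≈⟨ solve 4 (λ a s t p → (a :* s :+ t) :* p := t :* p :+ a :* (s :* p)) refl _ _ _ _ ⟩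
    κ (S i k) * m ^ (i ∸ k) + κ (suc k) * (κ (S i (suc k)) * m ^ (i ∸ k))
      ≈⟨ +-cong (·ℕ≈κ* (S i k) _) (*-congˡ (·ℕ≈κ* (S i (suc k)) _)) ⟨
    T i k + κ (suc k) * (S i (suc k) ·ℕ m ^ (i ∸ k))
      ≈⟨ +-congˡ (*-congˡ (T-*-m i k)) ⟩
    T i k + κ (suc k) * (m * T i (suc k))
      ≈⟨ +-congˡ (*-assoc _ _ _) ⟨
    T i k + κ (suc k) * m * T i (suc k) ∎

  -- The length N is independent of n because Pascal's rule produces a sum with one term more.
  F : ℕ → ℕ → ℕ → Carrier
  F N n k = ∑ N (λ i → κ (n C i) * T i k)

  W≈F : ∀ n k → W n k ≈ F (suc n) n k
  W≈F n k = sym (begin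
    F (suc n) n k
      ≈⟨ ∑-vanishing-initial k (suc n) _ (λ i i<k → trans (*-congˡ (T-vanishing i k i<k)) (zeroʳ _)) ⟩
    ∑ (suc n ∸ k) (λ i → κ (n C (k ℕ.+ i)) * T (k ℕ.+ i) k)
      ≈⟨ ∑-cong (suc n ∸ k) (λ i →
           trans (sym (·ℕ≈κ* (n C (k ℕ.+ i)) _)) (×-assocˡ _ (n C (k ℕ.+ i)) (S (k ℕ.+ i) k))) ⟩
    ∑ (suc n ∸ k) (λ i → ((n C (k ℕ.+ i)) ℕ.* S (k ℕ.+ i) k) ·ℕ m ^ (k ℕ.+ i ∸ k))
      ≈⟨ ∑≈sum (suc n ∸ k) _ ⟩
    W n k ∎)

  W-vanishing : ∀ n k → n ℕ.< k → W n k ≈ 0#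
  W-vanishing n k n<k = trans (sym (∑≈sum (suc n ∸ k) f)) (∑-empty (ℕₚ.m≤n⇒m∸n≡0 n<k))
    where
    f : Seq
    f i = ((n C (k ℕ.+ i)) ℕ.* S (k ℕ.+ i) k) ·ℕ m ^ (k ℕ.+ i ∸ k)
    ∑-empty : ∀ {N f} → N ≡ 0 → ∑ N f ≈ 0#
    ∑-empty ≡.refl = ∑-zero _

  W-zero : W 0 ≋ e 0
  W-zero zero    = trans (+-identityʳ _) (+-identityʳ 1#)
  W-zero (suc k) = W-vanishing 0 (suc k) (ℕ.s≤s ℕ.z≤n)

  -- Pascal's rule splits the sum in two: in one part the index of `T` goes up and `T-suc` applies,
  -- the other part is `W n k` again. The recurrence expresses that z^n is the sum of the `W n k`
  -- times ∏_{i<k} (z - 1 - i m).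
  W-suc : ∀ n k → W (suc n) k ≈ shift (W n) k + (1# + κ k * m) * W n k
  W-suc n k = begin
    W (suc n) k
      ≈⟨ trans (W≈F (suc n) k) (∑-suc (suc n) _) ⟩
    κ (suc n C 0) * T 0 k + ∑ (suc n) (λ i → κ (suc n C suc i) * T (suc i) k)
      ≈⟨ +-congˡ (∑-cong (suc n) (λ i → trans
           (*-congʳ (trans (κ-cong (≡.sym (nCk+nC[k+1]≡[n+1]C[k+1] n i))) (κ-+ (n C i) (n C suc i))))
           (distribʳ _ _ _))) ⟩
    κ (n C 0) * T 0 k + ∑ (suc n) (λ i → κ (n C i) * T (suc i) k + κ (n C suc i) * T (suc i) k)
      ≈⟨ +-congˡ (∑-+ (suc n) _ _) ⟩
    κ (n C 0) * T 0 k + (∑ (suc n) (λ i → κ (n C i) * T (suc i) k) + ∑ (suc n) (λ i → κ (n C suc i) * T (suc i) k))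
      ≈⟨ solve 3 (λ x y z → x :+ (y :+ z) := y :+ (x :+ z)) refl _ _ _ ⟩
    ∑ (suc n) (λ i → κ (n C i) * T (suc i) k) + (κ (n C 0) * T 0 k + ∑ (suc n) (λ i → κ (n C suc i) * T (suc i) k))
      -- The detached term of index 0 completes the second part, which now runs up to i = n + 1; its
      -- last term contains `n C suc n`, hence vanishes.
      ≈⟨ +-congˡ (∑-suc (suc n) _) ⟨
    ∑ (suc n) (λ i → κ (n C i) * T (suc i) k) + F (suc (suc n)) n k
      ≈⟨ +-cong first second ⟩
    (shift (W n) k + κ k * m * W n k) + W n k
      ≈⟨ +-congˡ (*-identityˡ _) ⟨
    (shift (W n) k + κ k * m * W n k) + 1# * W n k
      ≈⟨ solve 4 (λ s c u w → (s :+ c :* w) :+ u :* w := s :+ (u :+ c) :* w) refl _ _ _ _ ⟩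
    shift (W n) k + (1# + κ k * m) * W n k ∎
    where
    second : F (suc (suc n)) n k ≈ W n k
    second = begin
      F (suc (suc n)) n k
        ≈⟨ ∑-vanishing-last (suc n) _ (trans (*-congʳ (κ-cong (k>n⇒nCk≡0 (ℕₚ.n<1+n n)))) (zeroˡ _)) ⟩
      F (suc n) n k
        ≈⟨ W≈F n k ⟨
      W n k ∎
    first : ∑ (suc n) (λ i → κ (n C i) * T (suc i) k) ≈ shift (W n) k + κ k * m * W n k
    first = begin
      ∑ (suc n) (λ i → κ (n C i) * T (suc i) k)
        ≈⟨ ∑-cong (suc n) (λ i → trans (*-congˡ (T-suc i k))
             (solve 4 (λ r s c t → r :* (s :+ c :* t) := r :* s :+ c :* (r :* t)) refl _ _ _ _)) ⟩
      ∑ (suc n) (λ i → κ (n C i) * shift (T i) k + κ k * m * (κ (n C i) * T i k))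
        ≈⟨ ∑-+ (suc n) _ _ ⟩
      ∑ (suc n) (λ i → κ (n C i) * shift (T i) k) + ∑ (suc n) (λ i → κ k * m * (κ (n C i) * T i k))
        ≈⟨ +-cong (sym (shift-∑ (suc n) _ T k)) (∑-* (suc n) _ _) ⟩
      shift (F (suc n) n) k + κ k * m * F (suc n) n k
        ≈⟨ +-cong (shift-cong (λ j → W≈F n j) k) (*-congˡ (W≈F n k)) ⟨
      shift (W n) k + κ k * m * W n k ∎

-- The connection coefficients

-- D k j = (k choose j)² (k - j)!
D : ℕ → ℕ → ℕ
D zero    zero    = 1
D zero    (suc j) = 0
D (suc k) zero    = suc k ℕ.* D k zero
D (suc k) (suc j) = D k j ℕ.+ (suc (suc j) ℕ.+ k) ℕ.* D k (suc j)

D-zero : ∀ k → D k 0 ≡ k !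
D-zero zero    = ≡.refl
D-zero (suc k) = ≡.cong (suc k ℕ.*_) (D-zero k)

-- By the closed form, neighbouring entries satisfy (k - j) D k j = (j + 1)² D k (j + 1); the j-term
-- is moved to the right to stay within ℕ. The factor (j + 1)² is the one in λⱼ₊₁.
D-contiguous : ∀ k j → k ℕ.* D k j ≡ j ℕ.* D k j ℕ.+ suc j ℕ.* suc j ℕ.* D k (suc j)
D-contiguous zero    zero    = ≡.refl
D-contiguous zero    (suc j) = ≡.sym (≡.cong₂ ℕ._+_ (ℕₚ.*-zeroʳ j) (ℕₚ.*-zeroʳ (suc (suc j) ℕ.* suc (suc j))))
D-contiguous (suc k) zero    = begin
  suc k ℕ.* (suc k ℕ.* D k 0)
    ≡⟨ solve 2 (λ k d → (con 1 :+ k) :* ((con 1 :+ k) :* d) := (con 1 :+ k) :* d :+ (con 1 :+ k) :* (k :* d))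
         ≡.refl k (D k 0) ⟩
  suc k ℕ.* D k 0 ℕ.+ suc k ℕ.* (k ℕ.* D k 0)
    ≡⟨ ≡.cong (λ t → suc k ℕ.* D k 0 ℕ.+ suc k ℕ.* t) (D-contiguous k 0) ⟩
  suc k ℕ.* D k 0 ℕ.+ suc k ℕ.* (1 ℕ.* D k 1)
    ≡⟨ solve 3 (λ k d d′ → (con 1 :+ k) :* d :+ (con 1 :+ k) :* (con 1 :* d′) := d :+ (k :* d :+ (con 1 :+ k) :* d′))
         ≡.refl k (D k 0) (D k 1) ⟩
  D k 0 ℕ.+ (k ℕ.* D k 0 ℕ.+ suc k ℕ.* D k 1)
    ≡⟨ ≡.cong (λ t → D k 0 ℕ.+ (t ℕ.+ suc k ℕ.* D k 1)) (D-contiguous k 0) ⟩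
  D k 0 ℕ.+ (1 ℕ.* D k 1 ℕ.+ suc k ℕ.* D k 1)
    ≡⟨ solve 3 (λ k d d′ → d :+ (con 1 :* d′ :+ (con 1 :+ k) :* d′) := con 1 :* (d :+ (con 2 :+ k) :* d′))
         ≡.refl k (D k 0) (D k 1) ⟩
  1 ℕ.* D (suc k) 1 ∎
  where open ≡.≡-Reasoning; open +-*-Solver
-- The hypothesis at j + 1 enters with the factor j + k + 3, and the part of it in (j + 1) d would
-- have to be subtracted. That part is added to both sides instead and cancelled.
D-contiguous (suc k) (suc j) = ℕₚ.+-cancelʳ-≡ ((2+j ℕ.+ suc k) ℕ.* (1+j ℕ.* d)) _ _ (begin
  suc k ℕ.* (c ℕ.+ (2+j ℕ.+ k) ℕ.* d) ℕ.+ (2+j ℕ.+ suc k) ℕ.* (1+j ℕ.* d)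
    ≡⟨ solve 4 (λ k j c d → (con 1 :+ k) :* (c :+ (con 2 :+ j :+ k) :* d) :+ (con 2 :+ j :+ (con 1 :+ k)) :* ((con 1 :+ j) :* d) :=
         (c :+ k :* c) :+ ((con 1 :+ k) :* ((con 2 :+ j :+ k) :* d) :+ (con 2 :+ j :+ (con 1 :+ k)) :* ((con 1 :+ j) :* d)))
       ≡.refl k j c d ⟩
  (c ℕ.+ k ℕ.* c) ℕ.+ (suc k ℕ.* ((2+j ℕ.+ k) ℕ.* d) ℕ.+ (2+j ℕ.+ suc k) ℕ.* (1+j ℕ.* d))
    ≡⟨ ≡.cong (λ t → (c ℕ.+ t) ℕ.+ (suc k ℕ.* ((2+j ℕ.+ k) ℕ.* d) ℕ.+ (2+j ℕ.+ suc k) ℕ.* (1+j ℕ.* d))) (D-contiguous k j) ⟩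
  (c ℕ.+ (j ℕ.* c ℕ.+ 1+j ℕ.* 1+j ℕ.* d)) ℕ.+ (suc k ℕ.* ((2+j ℕ.+ k) ℕ.* d) ℕ.+ (2+j ℕ.+ suc k) ℕ.* (1+j ℕ.* d))
    ≡⟨ solve 4 (λ k j c d →
         (c :+ (j :* c :+ (con 1 :+ j) :* (con 1 :+ j) :* d)) :+
           ((con 1 :+ k) :* ((con 2 :+ j :+ k) :* d) :+ (con 2 :+ j :+ (con 1 :+ k)) :* ((con 1 :+ j) :* d)) :=
         (con 1 :+ j) :* (c :+ (con 2 :+ j :+ k) :* d) :+ (con 2 :+ j) :* (con 2 :+ j) :* d :+
           (con 2 :+ j :+ (con 1 :+ k)) :* (k :* d)) ≡.refl k j c d ⟩
  1+j ℕ.* (c ℕ.+ (2+j ℕ.+ k) ℕ.* d) ℕ.+ 2+j ℕ.* 2+j ℕ.* d ℕ.+ (2+j ℕ.+ suc k) ℕ.* (k ℕ.* d)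
    ≡⟨ ≡.cong (λ t → 1+j ℕ.* (c ℕ.+ (2+j ℕ.+ k) ℕ.* d) ℕ.+ 2+j ℕ.* 2+j ℕ.* d ℕ.+ (2+j ℕ.+ suc k) ℕ.* t) (D-contiguous k 1+j) ⟩
  1+j ℕ.* (c ℕ.+ (2+j ℕ.+ k) ℕ.* d) ℕ.+ 2+j ℕ.* 2+j ℕ.* d ℕ.+ (2+j ℕ.+ suc k) ℕ.* (1+j ℕ.* d ℕ.+ 2+j ℕ.* 2+j ℕ.* d′)
    ≡⟨ solve 5 (λ k j c d d′ →
         (con 1 :+ j) :* (c :+ (con 2 :+ j :+ k) :* d) :+ (con 2 :+ j) :* (con 2 :+ j) :* d :+
           (con 2 :+ j :+ (con 1 :+ k)) :* ((con 1 :+ j) :* d :+ (con 2 :+ j) :* (con 2 :+ j) :* d′) :=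
         (con 1 :+ j) :* (c :+ (con 2 :+ j :+ k) :* d) :+ (con 2 :+ j) :* (con 2 :+ j) :* (d :+ (con 3 :+ j :+ k) :* d′) :+
           (con 2 :+ j :+ (con 1 :+ k)) :* ((con 1 :+ j) :* d)) ≡.refl k j c d d′ ⟩
  1+j ℕ.* (c ℕ.+ (2+j ℕ.+ k) ℕ.* d) ℕ.+ 2+j ℕ.* 2+j ℕ.* (d ℕ.+ (suc 2+j ℕ.+ k) ℕ.* d′) ℕ.+
    (2+j ℕ.+ suc k) ℕ.* (1+j ℕ.* d) ∎)
  where
  open ≡.≡-Reasoning
  open +-*-Solver
  1+j 2+j c d d′ : ℕ
  1+j = suc j
  2+j = suc (suc j)
  c   = D k j
  d   = D k (suc j)
  d′  = D k (suc (suc j))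

-- Moments of the specific Jacobi matrix

module EulerianJacobi {c ℓ} (R : CommutativeRing c ℓ) (y a : CommutativeRing.Carrier R) where
  open CommutativeRing R
  open SemiringSolver commutativeSemiring using (solve; _:+_; _:*_; _:=_)
  open SetoidReasoning setoid
  open Sequences R
  open Sums R
  open Casts R

  b l : ℕ → Carrier
  b n = (1# + y) + κ n * (1# + 1# + a)
  l n = κ (suc n) * κ (suc n) * (1# + a)

  open JacobiOperator R b l

  -- The coordinates of ∏_{i<k} (z - y - i a) in the basis (Pⱼ), that is, this product evaluated at
  -- J and applied to e₀.
  δ : ℕ → Seq
  δ k j = κ (D k j)

  δ-zero : δ 0 ≋ e 0
  δ-zero zero    = +-identityʳ 1#
  δ-zero (suc j) = refl

  δ-suc : ∀ k j → δ (suc k) j ≈ shift (δ k) j + (1# + κ j + κ k) * δ k j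
  δ-suc k zero    = begin
    κ (suc k ℕ.* D k 0)                   ≈⟨ κ-* (suc k) (D k 0) ⟩
    (1# + κ k) * δ k 0                    ≈⟨ *-congʳ (+-congʳ (+-identityʳ 1#)) ⟨
    (1# + 0# + κ k) * δ k 0               ≈⟨ +-identityˡ _ ⟨
    0# + (1# + 0# + κ k) * δ k 0          ∎
  δ-suc k (suc j) = begin
    κ (D k j ℕ.+ (suc (suc j) ℕ.+ k) ℕ.* D k (suc j))
      ≈⟨ κ-+ (D k j) _ ⟩
    δ k j + κ ((suc (suc j) ℕ.+ k) ℕ.* D k (suc j))
      ≈⟨ +-congˡ (trans (κ-* (suc (suc j) ℕ.+ k) (D k (suc j))) (*-congʳ (κ-+ (suc (suc j)) k))) ⟩
    δ k j + (1# + κ (suc j) + κ k) * δ k (suc j) ∎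

  δ-contiguous : ∀ k j → κ k * δ k j ≈ κ j * δ k j + κ (suc j) * κ (suc j) * δ k (suc j)
  δ-contiguous k j = begin
    κ k * δ k j
      ≈⟨ κ-* k (D k j) ⟨
    κ (k ℕ.* D k j)
      ≈⟨ κ-cong (D-contiguous k j) ⟩
    κ (j ℕ.* D k j ℕ.+ suc j ℕ.* suc j ℕ.* D k (suc j))
      ≈⟨ κ-+ (j ℕ.* D k j) _ ⟩
    κ (j ℕ.* D k j) + κ (suc j ℕ.* suc j ℕ.* D k (suc j))
      ≈⟨ +-cong (κ-* j (D k j)) (trans (κ-* (suc j ℕ.* suc j) (D k (suc j))) (*-congʳ (κ-* (suc j) (suc j)))) ⟩
    κ j * δ k j + κ (suc j) * κ (suc j) * δ k (suc j) ∎

  -- In coordinates, z = (z - y - k a) + (y + k a) applied to the k-th product. This is the one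
  -- place where the shape of `b` and `l` matters.
  Z-δ : ∀ k → Z (δ k) ≋ λ j → δ (suc k) j + (y + κ k * a) * δ k j
  Z-δ k j = begin
    shift (δ k) j + (b j * δ k j + l j * δ k (suc j))
      -- The factor 2 + a in `b` is split as 1 + (1 + a). The second part joins the `l` term, and
      -- `δ-contiguous` turns their sum into k (1 + a) times `δ k j`. Of this, k goes into the
      -- factor 1 + j + k of `δ-suc`, and k a remains.
      ≈⟨ solve 8 (λ s u y κj a q d d₊ →
           s :+ (((u :+ y) :+ κj :* (u :+ u :+ a)) :* d :+ q :* (u :+ a) :* d₊) :=
           (s :+ (u :* d :+ κj :* u :* d)) :+ (y :* d :+ (κj :* d :+ q :* d₊) :* (u :+ a)))
           refl (shift (δ k) j) 1# y (κ j) a (κ (suc j) * κ (suc j)) (δ k j) (δ k (suc j)) ⟩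
    (shift (δ k) j + (1# * δ k j + κ j * 1# * δ k j)) + (y * δ k j + (κ j * δ k j + κ (suc j) * κ (suc j) * δ k (suc j)) * (1# + a))
      ≈⟨ +-cong (+-congˡ (+-congˡ (*-congʳ (*-identityʳ (κ j))))) (+-congˡ (*-congʳ (sym (δ-contiguous k j)))) ⟩
    (shift (δ k) j + (1# * δ k j + κ j * δ k j)) + (y * δ k j + κ k * δ k j * (1# + a))
      ≈⟨ +-congˡ (+-congˡ (trans (distribˡ _ _ _) (+-congʳ (*-identityʳ _)))) ⟩
    (shift (δ k) j + (1# * δ k j + κ j * δ k j)) + (y * δ k j + (κ k * δ k j + κ k * δ k j * a))
      ≈⟨ solve 7 (λ s u κj κk y a d →
           (s :+ (u :* d :+ κj :* d)) :+ (y :* d :+ (κk :* d :+ κk :* d :* a)) :=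
           (s :+ (u :+ κj :+ κk) :* d) :+ (y :+ κk :* a) :* d)
           refl (shift (δ k) j) 1# (κ j) (κ k) y a (δ k j) ⟩
    (shift (δ k) j + (1# + κ j + κ k) * δ k j) + (y + κ k * a) * δ k j
      ≈⟨ +-congʳ (δ-suc k j) ⟨
    δ (suc k) j + (y + κ k * a) * δ k j ∎

  Z-∑ : ∀ N (r : Seq) (f : ℕ → Seq) → Z (λ j → ∑ N (λ k → r k * f k j)) ≋ λ j → ∑ N (λ k → r k * Z (f k) j)
  Z-∑ zero    r f j = trans (Z-cong (λ j → ∑-zero _) j) (trans (Z-0 j) (sym (∑-zero _)))
  Z-∑ (suc N) r f j = begin
    Z (λ j → ∑ (suc N) (λ k → r k * f k j)) j
      ≈⟨ Z-cong (λ j → ∑-suc N _) j ⟩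
    Z (λ j → r 0 * f 0 j + ∑ N (λ k → r (suc k) * f (suc k) j)) j
      ≈⟨ Z-+ _ _ j ⟩
    Z (λ j → r 0 * f 0 j) j + Z (λ j → ∑ N (λ k → r (suc k) * f (suc k) j)) j
      ≈⟨ +-cong (Z-* (r 0) (f 0) j) (Z-∑ N (λ k → r (suc k)) (λ k → f (suc k)) j) ⟩
    r 0 * Z (f 0) j + ∑ N (λ k → r (suc k) * Z (f (suc k)) j)
      ≈⟨ ∑-suc N _ ⟨
    ∑ (suc N) (λ k → r k * Z (f k) j) ∎

  -- The hypotheses make `w n k` the coefficient of ∏_{i<k} (z - y - i a) in z^n.
  module Expansion (w : ℕ → Seq) (w-zero : w 0 ≋ e 0)
                   (w-suc : ∀ n k → w (suc n) k ≈ shift (w n) k + (y + κ k * a) * w n k) where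

    w-vanishing : ∀ n k → n ℕ.< k → w n k ≈ 0#
    w-vanishing zero    (suc k) n<k         = w-zero (suc k)
    w-vanishing (suc n) (suc k) (ℕ.s≤s n<k) = begin
      w (suc n) (suc k)
        ≈⟨ w-suc n (suc k) ⟩
      w n k + (y + κ (suc k) * a) * w n (suc k)
        ≈⟨ +-cong (w-vanishing n k n<k) (*-congˡ (w-vanishing n (suc k) (ℕₚ.m<n⇒m<1+n n<k))) ⟩
      0# + (y + κ (suc k) * a) * 0#
        ≈⟨ trans (+-identityˡ _) (zeroʳ _) ⟩
      0# ∎

    Z^-e₀ : ∀ n → Z^ n (e 0) ≋ λ j → ∑ (suc n) (λ k → w n k * δ k j)
    Z^-e₀ zero    j = begin
      e 0 j                ≈⟨ δ-zero j ⟨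
      δ 0 j                ≈⟨ *-identityˡ _ ⟨
      1# * δ 0 j           ≈⟨ *-congʳ (w-zero 0) ⟨
      w 0 0 * δ 0 j        ≈⟨ trans (+-congˡ (∑-zero _)) (+-identityʳ _) ⟨
      w 0 0 * δ 0 j + ∑ 0 (λ k → w 0 (suc k) * δ (suc k) j) ≈⟨ ∑-suc 0 _ ⟨
      ∑ 1 (λ k → w 0 k * δ k j) ∎
    Z^-e₀ (suc n) j = begin
      Z (Z^ n (e 0)) j
        ≈⟨ trans (Z-cong (Z^-e₀ n) j) (Z-∑ (suc n) (w n) δ j) ⟩
      ∑ (suc n) (λ k → w n k * Z (δ k) j)
        ≈⟨ ∑-cong (suc n) (λ k → trans (*-congˡ (Z-δ k j))
             (solve 4 (λ w d₊ c d → w :* (d₊ :+ c :* d) := w :* d₊ :+ c :* w :* d) refl _ _ _ _)) ⟩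
      ∑ (suc n) (λ k → w n k * δ (suc k) j + (y + κ k * a) * w n k * δ k j)
        ≈⟨ ∑-+ (suc n) _ _ ⟩
      ∑ (suc n) (λ k → w n k * δ (suc k) j) + ∑ (suc n) (λ k → (y + κ k * a) * w n k * δ k j)
        ≈⟨ +-cong first second ⟩
      ∑ (suc (suc n)) (λ k → shift (w n) k * δ k j) + ∑ (suc (suc n)) (λ k → (y + κ k * a) * w n k * δ k j)
        ≈⟨ ∑-+ (suc (suc n)) _ _ ⟨
      ∑ (suc (suc n)) (λ k → shift (w n) k * δ k j + (y + κ k * a) * w n k * δ k j)
        ≈⟨ ∑-cong (suc (suc n)) (λ k → trans (*-congʳ (w-suc n k)) (distribʳ _ _ _)) ⟨
      ∑ (suc (suc n)) (λ k → w (suc n) k * δ k j) ∎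
      where
      first : ∑ (suc n) (λ k → w n k * δ (suc k) j) ≈ ∑ (suc (suc n)) (λ k → shift (w n) k * δ k j)
      first = sym (trans (∑-suc (suc n) _) (trans (+-congʳ (zeroˡ _)) (+-identityˡ _)))
      second : ∑ (suc n) (λ k → (y + κ k * a) * w n k * δ k j) ≈ ∑ (suc (suc n)) (λ k → (y + κ k * a) * w n k * δ k j)
      second = sym (∑-vanishing-last (suc n) (λ k → (y + κ k * a) * w n k * δ k j)
        (trans (*-congʳ (trans (*-congˡ (w-vanishing n (suc n) (ℕₚ.n<1+n n))) (zeroʳ _))) (zeroˡ _)))

    -- The coordinate at 0 of `δ k` is k!, the value of the functional on the k-th product.
    Z^-e₀-head : ∀ n → Z^ n (e 0) 0 ≈ ∑ (suc n) (λ k → κ (k !) * w n k)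
    Z^-e₀-head n = trans (Z^-e₀ n 0) (∑-cong (suc n) (λ k →
      trans (*-congˡ (κ-cong (D-zero k))) (*-comm _ _)))

-- Whitney numbers as coefficients of the moments

module WhitneyMoments {c₁ ℓ₁ c₂ ℓ₂} (R : CommutativeRing c₁ ℓ₁) (A : CommutativeRing c₂ ℓ₂)
  {⟦_⟧ : CommutativeRing.Carrier R → CommutativeRing.Carrier A}
  (hom : SemiringMorphisms.IsSemiringHomomorphism (Semiring.rawSemiring (CommutativeRing.semiring R))
           (Semiring.rawSemiring (CommutativeRing.semiring A)) ⟦_⟧)
  (m : CommutativeRing.Carrier R) (y : CommutativeRing.Carrier A) where
  private
    module R = CommutativeRing R
    module R-Casts = Casts R
    module R-Sequences = Sequences R
  open CommutativeRing A
  open SemiringMorphisms.IsSemiringHomomorphism hom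
  open SemiringSolver commutativeSemiring using (solve; _:+_; _:*_; _:=_)
  open SetoidReasoning setoid
  open Sequences A
  open Sums A
  open Casts A
  open Whitney R m using (W; W-zero; W-suc; W-vanishing)
  open RingOperations A using (_^_; _·ℕ_; sumFromTo)
  open EulerianJacobi A y (⟦ m ⟧ * y) public
  open JacobiOperator A b l using (Z^)

  -- The Whitney numbers are formed in R, where m lives, and only then mapped to A; this matches
  -- `eulerianDowling`, which applies `const` to each of them.
  w : ℕ → Seq
  w n k = ⟦ W n k ⟧ * y ^ (n ∸ k)

  w-zero : w 0 ≋ e 0
  w-zero zero    = trans (*-identityʳ _) (trans (⟦⟧-cong (W-zero 0)) 1#-homo)
  w-zero (suc k) = trans (*-congʳ (trans (⟦⟧-cong (W-zero (suc k))) 0#-homo)) (zeroˡ (y ^ 0))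

  ⟦W⟧-suc : ∀ n k → ⟦ W (suc n) k ⟧ ≈ ⟦ R-Sequences.shift (W n) k ⟧ + (1# + κ k * ⟦ m ⟧) * ⟦ W n k ⟧
  ⟦W⟧-suc n k = begin
    ⟦ W (suc n) k ⟧
      ≈⟨ trans (⟦⟧-cong (W-suc n k)) (+-homo _ _) ⟩
    ⟦ R-Sequences.shift (W n) k ⟧ + ⟦ (R.1# R.+ R-Casts.κ k R.* m) R.* W n k ⟧
      ≈⟨ +-congˡ (trans (*-homo _ _) (*-congʳ (+-homo _ _))) ⟩
    ⟦ R-Sequences.shift (W n) k ⟧ + (⟦ R.1# ⟧ + ⟦ R-Casts.κ k R.* m ⟧) * ⟦ W n k ⟧
      ≈⟨ +-congˡ (*-congʳ (+-cong 1#-homo (trans (*-homo _ m) (*-congʳ (κ-homo R A hom k))))) ⟩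
    ⟦ R-Sequences.shift (W n) k ⟧ + (1# + κ k * ⟦ m ⟧) * ⟦ W n k ⟧ ∎

  shift-w : ∀ n k → ⟦ R-Sequences.shift (W n) k ⟧ * y ^ (suc n ∸ k) ≈ shift (w n) k
  shift-w n zero    = trans (*-congʳ 0#-homo) (zeroˡ _)
  shift-w n (suc k) = refl

  -- The exponents differ by one only for k ≤ n; for larger k both sides vanish together with
  -- `W n k`.
  ⟦W⟧-* : ∀ n k → ⟦ W n k ⟧ * y ^ (suc n ∸ k) ≈ y * w n k
  ⟦W⟧-* n k with ℕₚ.≤-<-connex k n
  ... | inj₁ k≤n = begin
    ⟦ W n k ⟧ * y ^ (suc n ∸ k)    ≈⟨ *-congˡ (reflexive (≡.cong (y ^_) (ℕₚ.+-∸-assoc 1 k≤n))) ⟩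
    ⟦ W n k ⟧ * (y * y ^ (n ∸ k))
      ≈⟨ solve 3 (λ c y p → c :* (y :* p) := y :* (c :* p)) refl ⟦ W n k ⟧ y (y ^ (n ∸ k)) ⟩
    y * (⟦ W n k ⟧ * y ^ (n ∸ k))  ∎
  ... | inj₂ n<k = begin
    ⟦ W n k ⟧ * y ^ (suc n ∸ k)    ≈⟨ trans (*-congʳ W≈0) (zeroˡ _) ⟩
    0#                             ≈⟨ trans (*-congˡ (trans (*-congʳ W≈0) (zeroˡ _))) (zeroʳ y) ⟨
    y * (⟦ W n k ⟧ * y ^ (n ∸ k))  ∎
    where
    W≈0 : ⟦ W n k ⟧ ≈ 0#
    W≈0 = trans (⟦⟧-cong (W-vanishing n k n<k)) 0#-homo

  -- The powers of y homogenise `W-suc`: its factor 1 + k m becomes y + k a with a = m y.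
  w-suc : ∀ n k → w (suc n) k ≈ shift (w n) k + (y + κ k * (⟦ m ⟧ * y)) * w n k
  w-suc n k = begin
    ⟦ W (suc n) k ⟧ * y ^ (suc n ∸ k)
      ≈⟨ *-congʳ (⟦W⟧-suc n k) ⟩
    (s + (1# + κ k * ⟦ m ⟧) * ⟦ W n k ⟧) * y ^ (suc n ∸ k)
      ≈⟨ solve 4 (λ s c w p → (s :+ c :* w) :* p := s :* p :+ c :* (w :* p)) refl
           s (1# + κ k * ⟦ m ⟧) ⟦ W n k ⟧ (y ^ (suc n ∸ k)) ⟩
    s * y ^ (suc n ∸ k) + (1# + κ k * ⟦ m ⟧) * (⟦ W n k ⟧ * y ^ (suc n ∸ k))
      ≈⟨ +-cong (shift-w n k) (*-congˡ (⟦W⟧-* n k)) ⟩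
    shift (w n) k + (1# + κ k * ⟦ m ⟧) * (y * w n k)
      ≈⟨ +-congˡ (solve 5 (λ u κ m y w → (u :+ κ :* m) :* (y :* w) := (u :* y :+ κ :* (m :* y)) :* w) refl
           1# (κ k) ⟦ m ⟧ y (w n k)) ⟩
    shift (w n) k + (1# * y + κ k * (⟦ m ⟧ * y)) * w n k
      ≈⟨ +-congˡ (*-congʳ (+-congʳ (*-identityˡ y))) ⟩
    shift (w n) k + (y + κ k * (⟦ m ⟧ * y)) * w n k ∎
    where
    s : Carrier
    s = ⟦ R-Sequences.shift (W n) k ⟧

  open Expansion w w-zero w-suc

  Z^-e₀-whitney : ∀ n → Z^ n (e 0) 0 ≈ sumFromTo 0 n (λ k → (k !) ·ℕ (⟦ W n k ⟧ * y ^ (n ∸ k)))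
  Z^-e₀-whitney n = begin
    Z^ n (e 0) 0                                              ≈⟨ Z^-e₀-head n ⟩
    ∑ (suc n) (λ k → κ (k !) * w n k)                         ≈⟨ ∑-cong (suc n) (λ k → ·ℕ≈κ* (k !) (w n k)) ⟨
    ∑ (suc n) (λ k → (k !) ·ℕ w n k)                          ≈⟨ ∑≈sum (suc n) _ ⟩
    sumFromTo 0 n (λ k → (k !) ·ℕ (⟦ W n k ⟧ * y ^ (n ∸ k)))  ∎

-- Orthogonality over the rational functions, and the case of ℂ

module _ {c ℓ} (R : CommutativeRing c ℓ) where
  private
    module R = CommutativeRing R
    module R[x] = CommutativeRing (Polynomial.commutativeRing R)
  open Polynomial R using (const; mk≈)
  open SemiringMorphisms (Semiring.rawSemiring R.semiring) (Semiring.rawSemiring R[x].semiring)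

  const-isHomomorphism : IsSemiringHomomorphism const
  const-isHomomorphism = record
    { isNearSemiringHomomorphism = record
      { +-isMonoidHomomorphism = record
        { isMagmaHomomorphism = record
          { isRelHomomorphism = record { cong = λ r≈s → mk≈ λ { zero → r≈s ; (suc _) → R.refl } }
          ; homo              = λ r s → R[x].refl
          }
        ; ε-homo = mk≈ λ { zero → R.refl ; (suc _) → R.refl }
        }
      ; *-homo = λ r s → mk≈ λ { zero → R.sym (R.+-identityʳ _) ; (suc _) → R.refl }
      }
    ; 1#-homo = R[x].refl
    }

module EulerianDowlingOrthogonality {c ℓ ν} (D : ApartnessDomain c ℓ ν) (m : ApartnessDomain.Carrier D)
  (κ≠0 : ∀ n → ApartnessDomain.NonZero D (Casts.κ (ApartnessDomain.commutativeRing D) (suc n))) where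
  private
    module D = ApartnessDomain D
    R[x] = Polynomial.commutativeRing D.commutativeRing
    R[x]-domain = PolynomialDomain.domain D
    module R[x] = ApartnessDomain R[x]-domain
    module Frac = FractionField R[x]-domain
    K = FractionField.heytingField R[x]-domain
    module Frac-ring = CommutativeRing Frac.commutativeRing
  open SemiringMorphisms (Semiring.rawSemiring R[x].semiring) (Semiring.rawSemiring Frac-ring.semiring)
  open RingProperties R[x].ring using (-0#≈0#)
  open Polynomial D.commutativeRing using (const; X)
  open Casts R[x] using (κ)

  y a : R[x].Carrier
  y = X R[x].- R[x].1#
  a = const m R[x].* y

  open WhitneyMoments D.commutativeRing R[x] (const-isHomomorphism D.commutativeRing) m y using (b; l; Z^-e₀-whitney)

  embed-isHomomorphism : IsSemiringHomomorphism Frac.embed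
  embed-isHomomorphism = record
    { isNearSemiringHomomorphism = record
      { +-isMonoidHomomorphism = record
        { isMagmaHomomorphism = record
          { isRelHomomorphism = record { cong = λ p≈q → Frac.mk≈ (R[x].*-congʳ {R[x].1#} p≈q) }
          ; homo = λ p q → Frac.mk≈ (solve 2 (λ p q → (p :+ q) :* (con 1 :* con 1) := (p :* con 1 :+ q :* con 1) :* con 1)
               R[x].refl p q)
          }
        ; ε-homo = Frac-ring.refl
        }
      ; *-homo = λ p q → Frac.mk≈ (solve 2 (λ p q → (p :* q) :* (con 1 :* con 1) := (p :* q) :* con 1) R[x].refl p q)
      }
    ; 1#-homo = Frac-ring.refl
    }
    where open SemiringSolver R[x].commutativeSemiring using (solve; _:+_; _:*_; _:=_; con)

  -- Apartness from `0/1` unfolds to `NonZero` of the numerator of a difference, which is p * 1 + (-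
  -- 0) * 1.
  embed#0 : ∀ {p} → R[x].NonZero p → HeytingField._#_ K (Frac.embed p) Frac.0/1
  embed#0 {p} = R[x].nonZero-resp (begin
    p                                            ≈⟨ R[x].*-identityʳ p ⟨
    p R[x].* R[x].1#                             ≈⟨ R[x].+-identityʳ _ ⟨
    p R[x].* R[x].1# R[x].+ R[x].0#
      ≈⟨ R[x].+-congˡ {p R[x].* R[x].1#} (R[x].trans (R[x].*-congʳ {R[x].1#} -0#≈0#) (R[x].zeroˡ R[x].1#)) ⟨
    p R[x].* R[x].1# R[x].+ (R[x].- R[x].0#) R[x].* R[x].1# ∎)
    where open SetoidReasoning R[x].setoid

  κ[x]≠0 : ∀ n → R[x].NonZero (κ (suc n))
  κ[x]≠0 n = R[x].nonZero-resp (κ-homo D.commutativeRing R[x] (const-isHomomorphism D.commutativeRing) (suc n)) (0 , κ≠0 n)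

  1+a≠0 : R[x].NonZero (R[x].1# R[x].+ a)
  -- No decision about m is made: since the two coefficients add up to 1, `nonZero-+` finds one of
  -- them to be nonzero.
  1+a≠0 = [ 0 ,_ , 1 ,_ ]′ (D.nonZero-+ (D.nonZero-resp sum≈1 D.nonZero-1))
    where
    open SemiringSolver D.commutativeSemiring using (solve; _:+_; _:*_; _:=_; con)
    open SetoidReasoning D.setoid
    -- The two summands are the coefficients of degree 0 and 1 of `1 + a`, in the form to which they
    -- compute.
    sum≈1 : D.1# D.≈ (D.1# D.+ (m D.* (D.0# D.+ D.- D.1#) D.+ D.0#)) D.+ m D.* D.1#
    sum≈1 = begin
      D.1#                                         ≈⟨ D.+-identityʳ D.1# ⟨
      D.1# D.+ D.0#                                ≈⟨ D.+-congˡ (D.trans (D.*-congˡ (D.-‿inverseˡ D.1#)) (D.zeroʳ m)) ⟨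
      D.1# D.+ m D.* (D.- D.1# D.+ D.1#)
        ≈⟨ solve 3 (λ u m n → u :+ m :* (n :+ u) := (u :+ (m :* (con 0 :+ n) :+ con 0)) :+ m :* u)
             D.refl D.1# m (D.- D.1#) ⟩
      (D.1# D.+ (m D.* (D.0# D.+ D.- D.1#) D.+ D.0#)) D.+ m D.* D.1# ∎

  l≠0 : ∀ n → R[x].NonZero (l n)
  l≠0 n = R[x].nonZero-* {κ (suc n) R[x].* κ (suc n)} (R[x].nonZero-* {κ (suc n)} (κ[x]≠0 n) (κ[x]≠0 n)) 1+a≠0

  open Favard K (λ n → Frac.embed (b n)) (λ n → Frac.embed (l n)) (λ n → embed#0 {l n} (l≠0 n))
  open Transport R[x] Frac.commutativeRing

  isMomentSequence : OrthogonalPolynomials.IsMomentSequenceOfOrthogonalPolynomials K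
    (λ n → Frac.embed (EulerianDowling.eulerianDowling D.commutativeRing m n))
  isMomentSequence = favard λ n → Frac-ring.trans
    (Frac-ring.sym (Z^-e₀-homo embed-isHomomorphism b l n 0))
    (IsSemiringHomomorphism.⟦⟧-cong embed-isHomomorphism (Z^-e₀-whitney n))

ℂ-κ≠0 : ∀ n → ApartnessDomain.NonZero Complex.domain (Casts.κ Complex.commutativeRing (suc n))
-- The real part is approximated by the constant sequence n + 1, which is at least 1 from index 0
-- on.
ℂ-κ≠0 n = inj₁ (Real.mkNonZero (1ℚ , ℚₚ.positive⁻¹ 1ℚ , 0 , λ i _ →
    ℚₚ.≤-trans (1≤approx n i) (ℚₚ.≤-reflexive (≡.sym (ℚₚ.0≤p⇒∣p∣≡p (0≤approx (suc n) i))))))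
  where
  approx-κ : ℕ → ℕ → Rat.ℚ
  approx-κ n = ℝ.approx (Complex.Carrier.re (Casts.κ Complex.commutativeRing n))
  0≤approx : ∀ n i → 0ℚ Rat.≤ approx-κ n i
  1≤approx : ∀ n i → 1ℚ Rat.≤ approx-κ (suc n) i
  0≤approx zero    i = ℚₚ.≤-refl
  0≤approx (suc n) i = ℚₚ.≤-trans (ℚₚ.<⇒≤ (ℚₚ.positive⁻¹ 1ℚ)) (1≤approx n i)
  1≤approx n i = ℚₚ.+-monoʳ-≤ 1ℚ (0≤approx n i)

proposition7 : (m : ℂ) → OrthogonalPolynomials.IsMomentSequenceOfOrthogonalPolynomials ℂ⟨x⟩ (λ n → embed (eulerianDowling m n))
proposition7 m = EulerianDowlingOrthogonality.isMomentSequence Complex.domain m ℂ-κ≠0
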